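{- Stabbing Planes polynomially simulates Cutting Planes: there is a polynomial $p$ such that, for every unsatisfiable system of integer linear inequalities of bit-length $L$ that has a Cutting Planes refutation of size $s$, there is a Stabbing Planes refutation of the same system of size at most $p(s+L)$.
   Context: A system of integer linear inequalities $Ax\ge b$ in real variables is unsatisfiable if it has no integer solution. Stabbing Planes (SP): an SP refutation of $Ax\ge b$ is a directed binary tree whose edges are labelled by integer linear inequalities such that: (internal nodes) if the right outgoing edge of an internal node is labelled $cx\ge d$ ($c$ an integer vector, $d$ an integer), then its left outgoing edge is labelled $cx\le d-1$; (leaves) each leaf is labelled with a conic (nonnegative) combination of inequalities of $Ax\ge b$ and of inequalities labelling the path from the root to that leaf which yields $0\ge 1$. The size is the bit-length needed to encode the whole tree (polynomially equivalent, for CNF formulas and suitably bounded systems, to the number of queries, i.e. internal nodes). Cutting Planes (CP): a CP refutation of $Ax\ge b$ is a sequence of integer linear inequalities ending in $0\ge 1$, each of which is an inequality of $Ax\ge b$ or is deduced from earlier ones (not necessarily used only once) by: conic combination (from $ax\ge b$ and $cx\ge d$ deduce any nonnegative linear combination of the two with integer coefficients), or division (from $ax\ge b$, if the positive integer $t$ divides all entries of $a$, deduce $(a/t)x\ge\lceil b/t\rceil$). The size is the number of inequalities in the sequence (polynomially equivalent to the bit-length of the proof). -}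

module Defs where

open import Data.Nat.Base as ℕ using (ℕ; suc; NonZero)
open import Data.Nat.Logarithm using (⌈log₂_⌉)
open import Data.Integer.Base as ℤ using (ℤ; +_; 0ℤ; 1ℤ; ∣_∣)
open import Data.Rational.Base as ℚ using (ℚ; 0ℚ; ↥_; ↧ₙ_; ceiling)
open import Data.Fin.Base using (Fin)
open import Data.List.Base as List using (List; []; _∷_; _++_; length)
open import Data.List.Membership.Propositional using (_∈_)
import Data.List.Relation.Unary.All as ListAll
open import Data.Product.Base using (Σ-syntax; ∃-syntax; _,_)
open import Data.Vec.Base as Vec using (Vec; []; _∷_; lookup; replicate; zipWith)
import Data.Vec.Relation.Unary.All as VecAll
open import Relation.Binary.PropositionalEquality.Core using (_≡_)
open import Relation.Nullary.Negation.Core using (¬_)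

infix 4 _·x≥_

record Inequality (n : ℕ) : Set where
  constructor _·x≥_
  field
    coeffs : Vec ℤ n
    rhs    : ℤ

open Inequality public

System : ℕ → Set
System n = List (Inequality n)

-- c x ≤ d, in the normal form (- c) x ≥ - d.
_·x≤_ : ∀ {n} → Vec ℤ n → ℤ → Inequality n
c ·x≤ d = Vec.map ℤ.-_ c ·x≥ (ℤ.- d)

0≥1 : ∀ {n} → Inequality n
0≥1 = replicate _ 0ℤ ·x≥ 1ℤ

dot : ∀ {n} → Vec ℤ n → Vec ℤ n → ℤ
dot a x = Vec.foldr′ ℤ._+_ 0ℤ (zipWith ℤ._*_ a x)

_Satisfies_ : ∀ {n} → Vec ℤ n → Inequality n → Set
x Satisfies (a ·x≥ b) = b ℤ.≤ dot a x

Unsatisfiable : ∀ {n} → System n → Set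
Unsatisfiable S = ¬ (∃[ x ] ListAll.All (x Satisfies_) S)

toℚ : ℤ → ℚ
toℚ z = z ℚ./ 1

weightedSum : ∀ {A : Set} (Γ : List A) → Vec ℚ (length Γ) → (A → ℤ) → ℚ
weightedSum []      []       f = 0ℚ
weightedSum (J ∷ Γ) (q ∷ qs) f = q ℚ.* toℚ (f J) ℚ.+ weightedSum Γ qs f

-- The weights may be fractional; only the resulting inequality I has to be
-- integral.  Rational weights lose nothing against real ones, since the
-- constraints on the weights are linear with integer coefficients.
record ConicCombination {n} (Γ : List (Inequality n)) (I : Inequality n) : Set where
  field
    weights     : Vec ℚ (length Γ)
    nonneg      : VecAll.All (0ℚ ℚ.≤_) weights
    coeffs-comb : ∀ (j : Fin n) →
                  weightedSum Γ weights (λ J → lookup (coeffs J) j) ≡ toℚ (lookup (coeffs I) j)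
    rhs-comb    : weightedSum Γ weights rhs ≡ toℚ (rhs I)

open ConicCombination public

-- Bit-lengths: ⌈log₂ (k + 1)⌉ is the number of binary digits of k (none for
-- k = 0); one further bit is charged for each sign and for the delimiter of
-- each composite object.

sizeℤ : ℤ → ℕ
sizeℤ z = 1 ℕ.+ ⌈log₂ suc ∣ z ∣ ⌉

sizeℚ : ℚ → ℕ
sizeℚ q = 1 ℕ.+ ⌈log₂ suc ∣ ↥ q ∣ ⌉ ℕ.+ ⌈log₂ suc (↧ₙ q) ⌉

sizeVec : ∀ {A : Set} {n} → (A → ℕ) → Vec A n → ℕ
sizeVec size v = 1 ℕ.+ Vec.sum (Vec.map size v)

sizeInequality : ∀ {n} → Inequality n → ℕ
sizeInequality (a ·x≥ b) = sizeVec sizeℤ a ℕ.+ sizeℤ b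

sizeSystem : ∀ {n} → System n → ℕ
sizeSystem S = 1 ℕ.+ List.sum (List.map sizeInequality S)

-- Γ lists the inequalities deduced so far, most recent first.
data CPStep {n} (S : System n) (Γ : List (Inequality n)) : Inequality n → Set where
  hypothesis : ∀ {I} → I ∈ S → CPStep S Γ I
  conic      : ∀ {I J K} → J ∈ Γ → K ∈ Γ → ConicCombination (J ∷ K ∷ []) I → CPStep S Γ I
  division   : ∀ {a a/t : Vec ℤ n} {b : ℤ} (t : ℕ) .{{_ : NonZero t}} →
               (a ·x≥ b) ∈ Γ → a ≡ Vec.map (+ t ℤ.*_) a/t →
               CPStep S Γ (a/t ·x≥ ceiling (b ℚ./ t))

data CPDerivation {n} (S : System n) : List (Inequality n) → Set where
  []  : CPDerivation S []
  _∷_ : ∀ {Γ I} → CPStep S Γ I → CPDerivation S Γ → CPDerivation S (I ∷ Γ)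

CPRefutation : ∀ {n} → System n → Set
CPRefutation S = ∃[ Γ ] CPDerivation S (0≥1 ∷ Γ)

sizeCP : ∀ {n} {S : System n} → CPRefutation S → ℕ
sizeCP (Γ , _) = suc (length Γ)

-- Subtrees below a node whose path from the root carries the edge labels P.
-- In `query c d left right` the edges to the two subtrees are labelled
-- c x ≤ d - 1 and c x ≥ d respectively.
data SPTree {n} (S : System n) (P : List (Inequality n)) : Set where
  leaf  : ConicCombination (S ++ P) 0≥1 → SPTree S P
  query : (c : Vec ℤ n) (d : ℤ) →
          SPTree S ((c ·x≤ (d ℤ.- 1ℤ)) ∷ P) → SPTree S ((c ·x≥ d) ∷ P) → SPTree S P

SPRefutation : ∀ {n} → System n → Set
SPRefutation S = SPTree S []

-- All labels are charged: both edges of each query, and the weights of the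
-- conic combination at each leaf.
sizeSP : ∀ {n} {S : System n} {P} → SPTree S P → ℕ
sizeSP (leaf κ)               = 1 ℕ.+ sizeVec sizeℚ (weights κ)
sizeSP (query c d left right) =
  1 ℕ.+ sizeInequality (c ·x≤ (d ℤ.- 1ℤ)) ℕ.+ sizeInequality (c ·x≥ d)
    ℕ.+ sizeSP left ℕ.+ sizeSP right

-- A univariate polynomial, constant coefficient first.  For upper bounds,
-- natural-number coefficients are as general as arbitrary ones.
Polynomial : Set
Polynomial = List ℕ

eval : Polynomial → ℕ → ℕ
eval []      x = 0
eval (c ∷ p) x = c ℕ.+ x ℕ.* eval p x

{-# OPTIONS --safe #-}
module Submission where

open import Defs
open import Data.Nat.Base using (ℕ; _+_; _≤_)
open import Data.Product.Base using (Σ-syntax)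

open import Data.Fin.Base using (Fin; zero; suc; toℕ; fromℕ<; funToFin; finToFun)
import Data.Fin.Properties as Fin
open import Data.Integer.Base as ℤ using (ℤ; +_; 0ℤ; 1ℤ; ∣_∣)
import Data.Integer.DivMod as ℤ
import Data.Integer.Properties as ℤ
open import Data.Integer.Tactic.RingSolver using () renaming (solve-∀ to ℤ-solve-∀)
open import Algebra.Properties.AbelianGroup ℤ.+-0-abelianGroup using (∙-cancelˡ)
open import Data.List.Base using (List; []; _∷_; _++_; length)
import Data.List.Properties as List
open import Data.List.Membership.Propositional using (_∈_)
open import Data.List.Membership.Propositional.Properties using (∈-++⁺ˡ)
open import Data.List.Relation.Unary.All as ListAll using ([]; _∷_)
import Data.List.Relation.Unary.All.Properties as ListAll
open import Data.List.Relation.Unary.Any using (here; there)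
open import Data.Nat.Base as ℕ using (zero; suc; NonZero; z≤n; s≤s)
open import Data.Nat.Divisibility using (n∣m*n)
import Data.Nat.DivMod as ℕ
open import Data.Nat.GCD using (gcd; gcd[m,n]≢0)
open import Data.Nat.Induction using (<-rec)
open import Data.Nat.Logarithm using (⌈log₂_⌉; ⌈log₂⌉-mono-≤; ⌈log₂2^n⌉≡n; ⌈log₂⌈n/2⌉⌉≡⌈log₂n⌉∸1)
import Data.Nat.Properties as ℕ
open import Data.Nat.Tactic.RingSolver using () renaming (solve-∀ to ℕ-solve-∀)
open import Data.Product.Base using (∃-syntax; _×_; _,_; proj₁; proj₂)
open import Data.Rational.Base as ℚ using (ℚ; 0ℚ; mkℚ; ceiling; ↥_; ↧_; ↧ₙ_; toℚᵘ)
import Data.Rational.Properties as ℚ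
open import Data.Rational.Unnormalised.Base as ℚᵘ using (mkℚᵘ; *≡*)
import Data.Rational.Unnormalised.Properties as ℚᵘ
open import Data.Sum.Base using (_⊎_; inj₁; inj₂)
open import Data.Vec.Base as Vec using (Vec; []; _∷_; lookup; tabulate; replicate)
import Data.Vec.Properties as Vec
import Data.Vec.Relation.Unary.All as VecAll
import Data.Vec.Relation.Unary.All.Properties as VecAll
open import Function.Base using (_∘_)
open import Relation.Binary.PropositionalEquality
open import Relation.Nullary.Decidable.Core using (yes; no)
open import Relation.Nullary.Negation.Core using (contradiction)

-- Stabbing Planes leaves may use arbitrary conic combinations, so only the
-- division steps of a Cutting Planes refutation need a query; the branch
-- violating the query is closed at once by a Farkas certificate.
--
-- Neither the coefficients of the given refutation nor its weights are bounded,
-- so two reductions keep the bit-length polynomial.  A division whose premise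
-- is a combination with weights t λᵢ is replaced by the one with weights t {λᵢ};
-- the integral parts ⌊λᵢ⌋ can be added back afterwards, and the entries of the
-- reduced inequality are at most the sum of the entries of its predecessors.
--
-- A Farkas certificate Σ Nᵢ aᵢ = 0, Σ Nᵢ bᵢ > 0 with Nᵢ ≤ Q is shrunk by walking
-- through the integer points Σ ⌊t Nᵢ / Q⌋ aᵢ for t = 0, …, Q.  Rounding keeps the
-- walk in a box of exponentially many points; if Q is larger, the walk revisits a
-- point, which splits the certificate into two, one of which is still positive.

private variable
  A : Set
  n : ℕ

-- Integer combinations

Weights : List A → Set
Weights Γ = Fin (length Γ) → ℕ

comb : (Γ : List A) → Weights Γ → (A → ℤ) → ℤ
comb []      w f = 0ℤ
comb (x ∷ Γ) w f = + w zero ℤ.* f x ℤ.+ comb Γ (w ∘ suc) f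

-- Two coefficients are allowed so that one induction covers sums, multiples and the recombination
-- of quotients with remainders.
comb-linear : ∀ p q (Γ : List A) {u v w : Weights Γ} f →
              (∀ i → p ℕ.* u i ℕ.+ q ℕ.* v i ≡ w i) →
              + p ℤ.* comb Γ u f ℤ.+ + q ℤ.* comb Γ v f ≡ comb Γ w f
comb-linear p q []      f eq = cong₂ ℤ._+_ (ℤ.*-zeroʳ (+ p)) (ℤ.*-zeroʳ (+ q))
comb-linear p q (x ∷ Γ) {u} {v} {w} f eq = begin
  + p ℤ.* (+ u zero ℤ.* f x ℤ.+ U) ℤ.+ + q ℤ.* (+ v zero ℤ.* f x ℤ.+ V)
    ≡⟨ rearrange (+ p) (+ q) (+ u zero) (+ v zero) (f x) U V ⟩
  (+ p ℤ.* + u zero ℤ.+ + q ℤ.* + v zero) ℤ.* f x ℤ.+ (+ p ℤ.* U ℤ.+ + q ℤ.* V)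
    ≡⟨ cong₂ ℤ._+_ (cong (ℤ._* f x) head) (comb-linear p q Γ f (eq ∘ suc)) ⟩
  + w zero ℤ.* f x ℤ.+ comb Γ (w ∘ suc) f ∎
  where
  open ≡-Reasoning
  U = comb Γ (u ∘ suc) f
  V = comb Γ (v ∘ suc) f
  rearrange : ∀ p q a b y s t → p ℤ.* (a ℤ.* y ℤ.+ s) ℤ.+ q ℤ.* (b ℤ.* y ℤ.+ t)
                              ≡ (p ℤ.* a ℤ.+ q ℤ.* b) ℤ.* y ℤ.+ (p ℤ.* s ℤ.+ q ℤ.* t)
  rearrange = ℤ-solve-∀
  head : + p ℤ.* + u zero ℤ.+ + q ℤ.* + v zero ≡ + w zero
  head = begin
    + p ℤ.* + u zero ℤ.+ + q ℤ.* + v zero ≡⟨ cong₂ ℤ._+_ (ℤ.pos-* p (u zero)) (ℤ.pos-* q (v zero)) ⟨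
    + (p ℕ.* u zero ℕ.+ q ℕ.* v zero)     ≡⟨ cong +_ (eq zero) ⟩
    + w zero                              ∎

comb-+ : (Γ : List A) {u v w : Weights Γ} (f : A → ℤ) → (∀ i → u i ℕ.+ v i ≡ w i) →
         comb Γ u f ℤ.+ comb Γ v f ≡ comb Γ w f
comb-+ Γ {u} {v} f eq = trans
  (sym (cong₂ ℤ._+_ (ℤ.*-identityˡ (comb Γ u f)) (ℤ.*-identityˡ (comb Γ v f))))
  (comb-linear 1 1 Γ f λ i → trans (cong₂ ℕ._+_ (ℕ.*-identityˡ (u i)) (ℕ.*-identityˡ (v i))) (eq i))

comb-* : ∀ p (Γ : List A) {u w : Weights Γ} f → (∀ i → p ℕ.* u i ≡ w i) →
         + p ℤ.* comb Γ u f ≡ comb Γ w f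
comb-* p Γ {u} f eq = trans (sym (ℤ.+-identityʳ _))
  (comb-linear p 0 Γ {u} {u} f λ i → trans (ℕ.+-identityʳ _) (eq i))

comb-bound : (Γ : List A) {w : Weights Γ} {f : A → ℤ} {c M : ℕ} → (∀ i → w i ℕ.≤ c) →
             ListAll.All (λ x → ∣ f x ∣ ℕ.≤ M) Γ → ∣ comb Γ w f ∣ ℕ.≤ length Γ ℕ.* (c ℕ.* M)
comb-bound []      w≤c []       = z≤n
comb-bound (x ∷ Γ) {w} {f} {c} {M} w≤c (b ∷ bs) = begin
  ∣ + w zero ℤ.* f x ℤ.+ comb Γ (w ∘ suc) f ∣         ≤⟨ ℤ.∣i+j∣≤∣i∣+∣j∣ (+ w zero ℤ.* f x) _ ⟩
  ∣ + w zero ℤ.* f x ∣ ℕ.+ ∣ comb Γ (w ∘ suc) f ∣     ≡⟨ cong (ℕ._+ _) (ℤ.abs-* (+ w zero) (f x)) ⟩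
  w zero ℕ.* ∣ f x ∣ ℕ.+ ∣ comb Γ (w ∘ suc) f ∣       ≤⟨ ℕ.+-mono-≤ (ℕ.*-mono-≤ (w≤c zero) b) (comb-bound Γ (w≤c ∘ suc) bs) ⟩
  c ℕ.* M ℕ.+ length Γ ℕ.* (c ℕ.* M)                  ∎
  where open ℕ.≤-Reasoning

-- Shrinking Farkas certificates

module _ (Q : ℕ) .{{_ : NonZero Q}} {a : ℕ} (a≤Q : a ℕ.≤ Q) where

  -- As `a` is at most `Q`, the additional time adds at most (t′ - t) Q to the dividend, and a
  -- multiple of `Q` passes through the floor unchanged.
  scaled-diff : ∀ {t t′} → t ℕ.≤ t′ → t′ ℕ.* a ℕ./ Q ℕ.≤ t ℕ.* a ℕ./ Q ℕ.+ (t′ ℕ.∸ t)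
  scaled-diff {t} {t′} t≤t′ = begin
    t′ ℕ.* a ℕ./ Q                             ≡⟨ cong (λ s → s ℕ.* a ℕ./ Q) (ℕ.m+[n∸m]≡n t≤t′) ⟨
    (t ℕ.+ (t′ ℕ.∸ t)) ℕ.* a ℕ./ Q             ≡⟨ cong (ℕ._/ Q) (ℕ.*-distribʳ-+ a t (t′ ℕ.∸ t)) ⟩
    (t ℕ.* a ℕ.+ (t′ ℕ.∸ t) ℕ.* a) ℕ./ Q       ≤⟨ ℕ./-monoˡ-≤ Q (ℕ.+-monoʳ-≤ (t ℕ.* a) (ℕ.*-monoʳ-≤ (t′ ℕ.∸ t) a≤Q)) ⟩
    (t ℕ.* a ℕ.+ (t′ ℕ.∸ t) ℕ.* Q) ℕ./ Q       ≡⟨ ℕ.+-distrib-/-∣ʳ (t ℕ.* a) (n∣m*n (t′ ℕ.∸ t)) ⟩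
    t ℕ.* a ℕ./ Q ℕ.+ (t′ ℕ.∸ t) ℕ.* Q ℕ./ Q   ≡⟨ cong (t ℕ.* a ℕ./ Q ℕ.+_) (ℕ.m*n/n≡m (t′ ℕ.∸ t) Q) ⟩
    t ℕ.* a ℕ./ Q ℕ.+ (t′ ℕ.∸ t)               ∎
    where open ℕ.≤-Reasoning

  module _ {t t′ : ℕ} (t≤t′ : t ℕ.≤ t′) (t′≤Q : t′ ℕ.≤ Q) where

    -- Steps taken by a column of multiplicity a inside and outside the time
    -- interval [t , t′]; rounding lets a column move at most once per time unit.
    inner outer : ℕ
    inner = t′ ℕ.* a ℕ./ Q ℕ.∸ t ℕ.* a ℕ./ Q
    outer = a ℕ.∸ inner

    start+inner : t ℕ.* a ℕ./ Q ℕ.+ inner ≡ t′ ℕ.* a ℕ./ Q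
    start+inner = ℕ.m+[n∸m]≡n (ℕ./-monoˡ-≤ Q (ℕ.*-monoˡ-≤ a t≤t′))

    private
      Q*a/Q≡a : Q ℕ.* a ℕ./ Q ≡ a
      Q*a/Q≡a = trans (cong (ℕ._/ Q) (ℕ.*-comm Q a)) (ℕ.m*n/n≡m a Q)

      end≤a : t′ ℕ.* a ℕ./ Q ℕ.≤ a
      end≤a = subst (t′ ℕ.* a ℕ./ Q ℕ.≤_) Q*a/Q≡a (ℕ./-monoˡ-≤ Q (ℕ.*-monoˡ-≤ a t′≤Q))

    inner+outer : inner ℕ.+ outer ≡ a
    inner+outer = ℕ.m+[n∸m]≡n (ℕ.≤-trans (ℕ.m∸n≤m _ (t ℕ.* a ℕ./ Q)) end≤a)

    inner-bound : inner ℕ.≤ t′ ℕ.∸ t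
    inner-bound = ℕ.m≤n+o⇒m∸n≤o _ (t ℕ.* a ℕ./ Q) (scaled-diff t≤t′)

    -- By time `Q` the column has taken all its `a` steps; at most `t` of them fall before `t` and
    -- at most Q - t′ after `t′`.
    outer-bound : outer ℕ.≤ Q ℕ.∸ t′ ℕ.+ t
    outer-bound = ℕ.m≤n+o⇒m∸n≤o a inner (begin
      a                                                  ≡⟨ Q*a/Q≡a ⟨
      Q ℕ.* a ℕ./ Q                                      ≤⟨ scaled-diff t′≤Q ⟩
      t′ ℕ.* a ℕ./ Q ℕ.+ (Q ℕ.∸ t′)                      ≡⟨ cong (ℕ._+ (Q ℕ.∸ t′)) start+inner ⟨
      t ℕ.* a ℕ./ Q ℕ.+ inner ℕ.+ (Q ℕ.∸ t′)             ≤⟨ ℕ.+-monoˡ-≤ (Q ℕ.∸ t′) (ℕ.+-monoˡ-≤ inner start≤t) ⟩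
      t ℕ.+ inner ℕ.+ (Q ℕ.∸ t′)                         ≡⟨ rearrange t inner (Q ℕ.∸ t′) ⟩
      inner ℕ.+ (Q ℕ.∸ t′ ℕ.+ t)                         ∎)
      where
      open ℕ.≤-Reasoning
      rearrange : ∀ x y z → x ℕ.+ y ℕ.+ z ≡ y ℕ.+ (z ℕ.+ x)
      rearrange = ℕ-solve-∀
      start≤t : t ℕ.* a ℕ./ Q ℕ.≤ t
      start≤t = subst (t ℕ.* a ℕ./ Q ℕ.≤_) (ℕ.m*n/n≡m t Q) (ℕ./-monoˡ-≤ Q (ℕ.*-monoʳ-≤ t a≤Q))

-- Shifting by `K` turns the coordinates into digits in base 2K + 1. A point of the box thus becomes
-- an element of a `Fin`, to which the pigeonhole principle applies.
boxCode : ∀ {d} K (p : Fin d → ℤ) → (∀ j → ∣ p j ∣ ℕ.≤ K) → Fin (suc (K ℕ.+ K) ℕ.^ d)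
boxCode K p p≤K = funToFin λ j →
  fromℕ< (s≤s (ℕ.≤-trans (ℤ.∣i+j∣≤∣i∣+∣j∣ (p j) (+ K)) (ℕ.+-monoˡ-≤ K (p≤K j))))

boxCode-injective : ∀ {d} K {p q : Fin d → ℤ} (p≤K : ∀ j → ∣ p j ∣ ℕ.≤ K) (q≤K : ∀ j → ∣ q j ∣ ℕ.≤ K) →
                    boxCode K p p≤K ≡ boxCode K q q≤K → ∀ j → p j ≡ q j
boxCode-injective {d} K {p} {q} p≤K q≤K eq j = begin
  p j                     ≡⟨ unshift (p j) (+ K) ⟩
  (p j ℤ.+ + K) ℤ.- + K   ≡⟨ cong (ℤ._- + K) shifted ⟩
  (q j ℤ.+ + K) ℤ.- + K   ≡⟨ unshift (q j) (+ K) ⟨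
  q j                     ∎
  where
  open ≡-Reasoning
  unshift : ∀ x k → x ≡ (x ℤ.+ k) ℤ.- k
  unshift = ℤ-solve-∀
  -- The digits are absolute values of shifted coordinates; these are nonnegative, so no sign is
  -- lost.
  0≤shift : ∀ z → ∣ z ∣ ℕ.≤ K → 0ℤ ℤ.≤ z ℤ.+ + K
  0≤shift (+ n) _ = ℤ.+≤+ z≤n
  0≤shift ℤ.-[1+ n ] n<K = subst (0ℤ ℤ.≤_) (sym (ℤ.⊖-≥ n<K)) (ℤ.+≤+ z≤n)
  digit : ∀ r (r≤K : ∀ j → ∣ r j ∣ ℕ.≤ K) → + toℕ (finToFun (boxCode K r r≤K) j) ≡ r j ℤ.+ + K
  digit r r≤K = trans (cong (λ x → + toℕ x) (Fin.finToFun-funToFin _ j))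
    (trans (cong +_ (Fin.toℕ-fromℕ< _)) (ℤ.0≤i⇒+∣i∣≡i (0≤shift (r j) (r≤K j))))
  shifted : p j ℤ.+ + K ≡ q j ℤ.+ + K
  shifted = trans (sym (digit p p≤K)) (trans (cong (λ c → + toℕ (finToFun {suc (K ℕ.+ K)} {d} c j)) eq) (digit q q≤K))

positive-summand : ∀ x y → 0ℤ ℤ.< x ℤ.+ y → 0ℤ ℤ.< x ⊎ 0ℤ ℤ.< y
positive-summand x y 0<x+y with 0ℤ ℤ.<? x
... | yes 0<x = inj₁ 0<x
... | no 0≮x  = inj₂ (ℤ.<-≤-trans 0<x+y
  (subst (x ℤ.+ y ℤ.≤_) (ℤ.+-identityˡ y) (ℤ.+-monoˡ-≤ y (ℤ.≮⇒≥ 0≮x))))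

record Certificate {d} (Γ : List A) (f : Fin d → A → ℤ) (g : A → ℤ) (bound : ℕ) : Set where
  constructor certificate
  field
    multiplicity : Weights Γ
    bounded      : ∀ i → multiplicity i ℕ.≤ bound
    vanishes     : ∀ j → comb Γ multiplicity (f j) ≡ 0ℤ
    positive     : 0ℤ ℤ.< comb Γ multiplicity g

module _ {d} (Γ : List A) (f : Fin d → A → ℤ) (g : A → ℤ) (M : ℕ)
         (small : ∀ j → ListAll.All (λ x → ∣ f j x ∣ ℕ.≤ M) Γ) where

  -- The number of integer points whose `d` coordinates have absolute value at most
  -- `length Γ ℕ.* M`, that is, of the points that the walk can visit.
  boxes : ℕ
  boxes = suc (length Γ ℕ.* M ℕ.+ length Γ ℕ.* M) ℕ.^ d

  module _ (Q : ℕ) .{{_ : NonZero Q}} (C : Certificate Γ f g Q) where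
    open Certificate C renaming (multiplicity to N)

    rounded : ℕ → Weights Γ
    rounded t i = t ℕ.* N i ℕ./ Q

    position : ℕ → Fin d → ℤ
    position t j = comb Γ (rounded t) (f j)

    -- Dividing each t Nᵢ by `Q` with remainder splits t Σ Nᵢ aᵢ = 0 into `Q` times the position and
    -- the combination with the remainders as weights. Those are at most `Q`, so the factor `Q`
    -- cancels from the estimate.
    position-bound : ∀ t j → ∣ position t j ∣ ℕ.≤ length Γ ℕ.* M
    position-bound t j = ℕ.*-cancelˡ-≤ Q (begin
      Q ℕ.* ∣ position t j ∣              ≡⟨ ℤ.abs-* (+ Q) (position t j) ⟨
      ∣ + Q ℤ.* position t j ∣            ≡⟨ cong ∣_∣ (isolate (+ Q ℤ.* position t j) (comb Γ remainder (f j)) division-identity) ⟩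
      ∣ ℤ.- (comb Γ remainder (f j)) ∣    ≡⟨ ℤ.∣-i∣≡∣i∣ (comb Γ remainder (f j)) ⟩
      ∣ comb Γ remainder (f j) ∣          ≤⟨ comb-bound Γ (λ i → ℕ.m%n≤n (t ℕ.* N i) Q) (small j) ⟩
      length Γ ℕ.* (Q ℕ.* M)              ≡⟨ rearrange (length Γ) Q M ⟩
      Q ℕ.* (length Γ ℕ.* M)              ∎)
      where
      open ℕ.≤-Reasoning
      remainder : Weights Γ
      remainder i = t ℕ.* N i ℕ.% Q
      rearrange : ∀ x y z → x ℕ.* (y ℕ.* z) ≡ y ℕ.* (x ℕ.* z)
      rearrange = ℕ-solve-∀
      isolate : ∀ x y → x ℤ.+ y ≡ 0ℤ → x ≡ ℤ.- y
      isolate x y eq = trans (move x y) (trans (cong (ℤ._- y) eq) (ℤ.+-identityˡ (ℤ.- y)))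
        where
        move : ∀ x y → x ≡ (x ℤ.+ y) ℤ.- y
        move = ℤ-solve-∀
      division-identity : + Q ℤ.* position t j ℤ.+ comb Γ remainder (f j) ≡ 0ℤ
      division-identity = trans
        (cong (ℤ._+_ (+ Q ℤ.* position t j)) (sym (ℤ.*-identityˡ (comb Γ remainder (f j)))))
        (trans (comb-linear Q 1 Γ {rounded t} {remainder} {λ i → t ℕ.* N i} (f j) λ i →
                  trans (trans (ℕ.+-comm (Q ℕ.* rounded t i) _) (cong₂ ℕ._+_ (ℕ.*-identityˡ (remainder i)) (ℕ.*-comm Q (rounded t i))))
                        (sym (ℕ.m≡m%n+[m/n]*n (t ℕ.* N i) Q)))
        (trans (sym (comb-* t Γ {N} (f j) λ _ → refl))
        (trans (cong (+ t ℤ.*_) (vanishes j)) (ℤ.*-zeroʳ (+ t)))))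

    split : boxes ℕ.< Q → ∃[ Q′ ] Q′ ℕ.< Q × Certificate Γ f g Q′
    split boxes<Q = case-split
      where
      -- The times 0, ..., `boxes` are one more than the points, so two of them collide. All are
      -- below `Q`, hence t′ < Q; together with t < t′ this puts both new bounds, t′ - t and Q - t′
      -- + t, strictly below `Q`.
      hit = Fin.pigeonhole {boxes} {suc boxes} ℕ.≤-refl (λ t → boxCode _ (position (toℕ t)) (position-bound (toℕ t)))
      t  = toℕ (proj₁ hit)
      t′ = toℕ (proj₁ (proj₂ hit))
      t<t′ : t ℕ.< t′
      t<t′ = proj₁ (proj₂ (proj₂ hit))
      t′<Q : t′ ℕ.< Q
      t′<Q = ℕ.≤-trans (Fin.toℕ<n (proj₁ (proj₂ hit))) boxes<Q
      same-position : ∀ j → position t j ≡ position t′ j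
      same-position = boxCode-injective _ (position-bound t) (position-bound t′) (proj₂ (proj₂ (proj₂ hit)))
      t≤t′ = ℕ.<⇒≤ t<t′
      t′≤Q = ℕ.<⇒≤ t′<Q
      N₁ N₂ : Weights Γ
      N₁ i = inner Q (bounded i) t≤t′ t′≤Q
      N₂ i = outer Q (bounded i) t≤t′ t′≤Q
      N₁+N₂ : ∀ h → comb Γ N₁ h ℤ.+ comb Γ N₂ h ≡ comb Γ N h
      N₁+N₂ h = comb-+ Γ h λ i → inner+outer Q (bounded i) t≤t′ t′≤Q
      vanishes₁ : ∀ j → comb Γ N₁ (f j) ≡ 0ℤ
      vanishes₁ j = ∙-cancelˡ (position t j) _ _ (trans
        (comb-+ Γ {rounded t} {N₁} {rounded t′} (f j) λ i → start+inner Q (bounded i) t≤t′ t′≤Q)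
        (trans (sym (same-position j)) (sym (ℤ.+-identityʳ _))))
      vanishes₂ : ∀ j → comb Γ N₂ (f j) ≡ 0ℤ
      vanishes₂ j = trans (sym (ℤ.+-identityˡ _)) (trans
        (cong (ℤ._+ comb Γ N₂ (f j)) (sym (vanishes₁ j))) (trans (N₁+N₂ (f j)) (vanishes j)))
      outer<Q : Q ℕ.∸ t′ ℕ.+ t ℕ.< Q
      outer<Q = ℕ.<-≤-trans (ℕ.+-monoʳ-< (Q ℕ.∸ t′) t<t′) (ℕ.≤-reflexive (ℕ.m∸n+n≡m t′≤Q))
      case-split : ∃[ Q′ ] Q′ ℕ.< Q × Certificate Γ f g Q′
      case-split with positive-summand _ _ (subst (0ℤ ℤ.<_) (sym (N₁+N₂ g)) positive)
      ... | inj₁ pos = t′ ℕ.∸ t , ℕ.≤-<-trans (ℕ.m∸n≤m t′ t) t′<Q ,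
            certificate N₁ (λ i → inner-bound Q (bounded i) t≤t′ t′≤Q) vanishes₁ pos
      ... | inj₂ pos = Q ℕ.∸ t′ ℕ.+ t , outer<Q ,
            certificate N₂ (λ i → outer-bound Q (bounded i) t≤t′ t′≤Q) vanishes₂ pos

  -- Well-founded descent on the bound: while it exceeds `boxes`, `split` lowers it strictly.
  small-certificate : ∀ {Q} → Certificate Γ f g Q → Certificate Γ f g boxes
  small-certificate {Q} = <-rec _ shrink Q
    where
    shrink : ∀ Q → (∀ {Q′} → Q′ ℕ.< Q → Certificate Γ f g Q′ → Certificate Γ f g boxes) →
             Certificate Γ f g Q → Certificate Γ f g boxes
    shrink Q rec C with Q ℕ.≤? boxes
    ... | yes Q≤boxes = record
      { Certificate C ; bounded = λ i → ℕ.≤-trans (Certificate.bounded C i) Q≤boxes }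
    ... | no Q≰boxes =
      let Q′ , Q′<Q , C′ = split Q {{ℕ.>-nonZero (ℕ.≤-<-trans z≤n (ℕ.≰⇒> Q≰boxes))}} C (ℕ.≰⇒> Q≰boxes)
      in rec Q′<Q C′

-- Rational weights and rounding

toℚᵘ-/ : ∀ x d .{{_ : NonZero d}} → toℚᵘ (x ℚ./ d) ℚᵘ.≃ x ℚᵘ./ d
toℚᵘ-/ x (suc d) = ℚ.toℚᵘ-fromℚᵘ (mkℚᵘ x d)

/-≡ : ∀ {x y d e} .{{_ : NonZero d}} .{{_ : NonZero e}} →
      x ℤ.* + e ≡ y ℤ.* + d → x ℚ./ d ≡ y ℚ./ e
/-≡ {x} {y} {suc d} {suc e} eq = ℚ.fromℚᵘ-cong {mkℚᵘ x d} {mkℚᵘ y e} (*≡* eq)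

/-≡⁻¹ : ∀ {x y d e} .{{_ : NonZero d}} .{{_ : NonZero e}} →
        x ℚ./ d ≡ y ℚ./ e → x ℤ.* + e ≡ y ℤ.* + d
/-≡⁻¹ {x} {y} {suc d} {suc e} eq with *≡* eq′ ← ℚ.fromℚᵘ-injective {mkℚᵘ x d} {mkℚᵘ y e} eq = eq′

-- This is the inductive step for weighted sums of fractions, reduced to a cross-multiplied identity
-- in ℤ. Passing through unnormalised rationals keeps greatest common divisors out of it.
scale-add : ∀ {x d y c D e E} .{{_ : NonZero d}} .{{_ : NonZero D}} .{{_ : NonZero E}} →
            (x ℤ.* y ℤ.* + D ℤ.+ c ℤ.* + d) ℤ.* + E ≡ e ℤ.* (+ d ℤ.* + D) →
            (x ℚ./ d) ℚ.* toℚ y ℚ.+ c ℚ./ D ≡ e ℚ./ E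
scale-add {x} {d@(suc _)} {y} {c} {D@(suc _)} {e} {E@(suc _)} eq = ℚ.toℚᵘ-injective (begin
  toℚᵘ ((x ℚ./ d) ℚ.* toℚ y ℚ.+ c ℚ./ D)
    ≈⟨ ℚ.toℚᵘ-homo-+ ((x ℚ./ d) ℚ.* toℚ y) (c ℚ./ D) ⟩
  toℚᵘ ((x ℚ./ d) ℚ.* toℚ y) ℚᵘ.+ toℚᵘ (c ℚ./ D)
    ≈⟨ ℚᵘ.+-cong (ℚᵘ.≃-trans (ℚ.toℚᵘ-homo-* (x ℚ./ d) (toℚ y)) (ℚᵘ.*-cong (toℚᵘ-/ x d) (toℚᵘ-/ y 1))) (toℚᵘ-/ c D) ⟩
  (x ℚᵘ./ d) ℚᵘ.* (y ℚᵘ./ 1) ℚᵘ.+ c ℚᵘ./ D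
    ≈⟨ *≡* identity ⟩
  e ℚᵘ./ E
    ≈⟨ toℚᵘ-/ e E ⟨
  toℚᵘ (e ℚ./ E) ∎)
  where
  open import Relation.Binary.Reasoning.Setoid ℚᵘ.≃-setoid
  identity : (x ℤ.* y ℤ.* + D ℤ.+ c ℤ.* + (d ℕ.* 1)) ℤ.* + E ≡ e ℤ.* + (d ℕ.* 1 ℕ.* D)
  identity = subst (λ k → (x ℤ.* y ℤ.* + D ℤ.+ c ℤ.* + k) ℤ.* + E ≡ e ℤ.* + (k ℕ.* D))
    (sym (ℕ.*-identityʳ d)) (trans eq (cong (ℤ._*_ e) (sym (ℤ.pos-* d D))))

weightedSum-tabulate : ∀ T .{{_ : NonZero T}} (Γ : List A) (w : Weights Γ) f →
                       weightedSum Γ (tabulate λ i → + w i ℚ./ T) f ≡ comb Γ w f ℚ./ T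
weightedSum-tabulate T []      w f = /-≡ {0ℤ} {0ℤ} {1} {T} refl
weightedSum-tabulate T (x ∷ Γ) w f = trans
  (cong ((+ w zero ℚ./ T) ℚ.* toℚ (f x) ℚ.+_) (weightedSum-tabulate T Γ (w ∘ suc) f))
  (scale-add {+ w zero} {T} {f x} {comb Γ (w ∘ suc) f} {T} {comb (x ∷ Γ) w f} (identity (+ w zero) (f x) (comb Γ (w ∘ suc) f) (+ T)))
  where
  identity : ∀ k y c t → (k ℤ.* y ℤ.* t ℤ.+ c ℤ.* t) ℤ.* t ≡ (k ℤ.* y ℤ.+ c) ℤ.* (t ℤ.* t)
  identity = ℤ-solve-∀

-- The same numerators serve every `f`, hence all coordinates and the right-hand side at once.
record IntegerWeights (Γ : List A) (qs : Vec ℚ (length Γ)) : Set where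
  constructor integerWeights
  field
    denominator     : ℕ
    {{denominator≢0}} : NonZero denominator
    numerators      : Weights Γ
    correct         : ∀ f → weightedSum Γ qs f ≡ comb Γ numerators f ℚ./ denominator

-- The product of the denominators is a common one. Its size never reaches the tree, since
-- multiplicities are reduced before any label is written.
clear-denominators : (Γ : List A) (qs : Vec ℚ (length Γ)) → VecAll.All (0ℚ ℚ.≤_) qs → IntegerWeights Γ qs
clear-denominators []      []       _ = integerWeights 1 (λ ()) (λ f → refl)
clear-denominators (x ∷ Γ) (mkℚ ℤ.-[1+ _ ] _ _ ∷ qs) (ℚ.*≤* () VecAll.∷ _)
clear-denominators (x ∷ Γ) (q@(mkℚ (+ k) d-1 _) ∷ qs) (_ VecAll.∷ 0≤qs)
  with integerWeights D w eq ← clear-denominators Γ qs 0≤qs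
  = integerWeights (d ℕ.* D) {{ℕ.m*n≢0 d D}} w′ λ f → trans
      (cong₂ (λ u v → u ℚ.* toℚ (f x) ℚ.+ v) (sym (ℚ.fromℚᵘ-toℚᵘ q)) (eq f))
      (scale-add {+ k} {d} {f x} {comb Γ w f} {D} {comb (x ∷ Γ) w′ f} {d ℕ.* D} {{_}} {{_}} {{ℕ.m*n≢0 d D}} (identity f))
  where
  d = suc d-1
  w′ : Weights (x ∷ Γ)
  w′ zero    = k ℕ.* D
  w′ (suc i) = d ℕ.* w i
  rearrange : ∀ k y D c d → (k ℤ.* y ℤ.* D ℤ.+ c ℤ.* d) ≡ k ℤ.* D ℤ.* y ℤ.+ d ℤ.* c
  rearrange = ℤ-solve-∀
  identity : ∀ f → (+ k ℤ.* f x ℤ.* + D ℤ.+ comb Γ w f ℤ.* + d) ℤ.* + (d ℕ.* D) ≡ comb (x ∷ Γ) w′ f ℤ.* (+ d ℤ.* + D)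
  identity f = cong₂ ℤ._*_ (trans (rearrange (+ k) (f x) (+ D) (comb Γ w f) (+ d))
      (cong₂ ℤ._+_ (cong (ℤ._* f x) (sym (ℤ.pos-* k D))) (comb-* d Γ f λ _ → refl))) (ℤ.pos-* d D)

⌈_/_⌉ : ℤ → ∀ d .{{_ : NonZero d}} → ℤ
⌈ x / d ⌉ = ℤ.- ((ℤ.- x) ℤ./ℕ d)

⌈/⌉-lower : ∀ x d .{{_ : NonZero d}} → x ℤ.≤ + d ℤ.* ⌈ x / d ⌉
⌈/⌉-lower x d = begin
  x                                   ≡⟨ ℤ.neg-involutive x ⟨
  ℤ.- (ℤ.- x)                         ≤⟨ ℤ.neg-mono-≤ (ℤ.[n/ℕd]*d≤n (ℤ.- x) d) ⟩
  ℤ.- ((ℤ.- x) ℤ./ℕ d ℤ.* + d)        ≡⟨ rearrange ((ℤ.- x) ℤ./ℕ d) (+ d) ⟩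
  + d ℤ.* ⌈ x / d ⌉                   ∎
  where
  open ℤ.≤-Reasoning
  rearrange : ∀ q d → ℤ.- (q ℤ.* d) ≡ d ℤ.* (ℤ.- q)
  rearrange = ℤ-solve-∀

⌈/⌉-upper : ∀ x d .{{_ : NonZero d}} → + d ℤ.* (⌈ x / d ⌉ ℤ.- 1ℤ) ℤ.< x
⌈/⌉-upper x d = begin-strict
  + d ℤ.* (⌈ x / d ⌉ ℤ.- 1ℤ)                   ≡⟨ rearrange ((ℤ.- x) ℤ./ℕ d) (+ d) ⟩
  ℤ.- (ℤ.suc ((ℤ.- x) ℤ./ℕ d) ℤ.* + d)         <⟨ ℤ.neg-mono-< (ℤ.n<s[n/ℕd]*d (ℤ.- x) d) ⟩
  ℤ.- (ℤ.- x)                                  ≡⟨ ℤ.neg-involutive x ⟩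
  x                                            ∎
  where
  open ℤ.≤-Reasoning
  rearrange : ∀ q d → d ℤ.* ((ℤ.- q) ℤ.- 1ℤ) ≡ ℤ.- ((1ℤ ℤ.+ q) ℤ.* d)
  rearrange = ℤ-solve-∀

-- The strict bound `⌈/⌉-upper` gives d (⌈x/d⌉ - 1) < d z; cancelling `d` leaves a strict inequality
-- between integers, which yields one unit.
⌈/⌉-least : ∀ {x z} d .{{_ : NonZero d}} → x ℤ.≤ + d ℤ.* z → ⌈ x / d ⌉ ℤ.≤ z
⌈/⌉-least {x} {z} d x≤dz = subst (ℤ._≤ z) (rearrange ⌈ x / d ⌉)
  (ℤ.i<j⇒suc[i]≤j (ℤ.*-cancelˡ-<-nonNeg (+ d) (ℤ.<-≤-trans (⌈/⌉-upper x d) x≤dz)))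
  where
  rearrange : ∀ c → 1ℤ ℤ.+ (c ℤ.- 1ℤ) ≡ c
  rearrange = ℤ-solve-∀

-- With r the remainder of -x modulo d, d ⌈x/d⌉ = r + x; since r < d, rounding costs at most one
-- unit beyond `K`.
⌈/⌉-bound : ∀ x d {K} .{{_ : NonZero d}} → ∣ x ∣ ℕ.≤ d ℕ.* K → ∣ ⌈ x / d ⌉ ∣ ℕ.≤ suc K
⌈/⌉-bound x d {K} ∣x∣≤dK = ℕ.*-cancelˡ-≤ d (begin
  d ℕ.* ∣ ⌈ x / d ⌉ ∣            ≡⟨ ℤ.abs-* (+ d) ⌈ x / d ⌉ ⟨
  ∣ + d ℤ.* ⌈ x / d ⌉ ∣          ≡⟨ cong ∣_∣ d*⌈⌉ ⟩
  ∣ + r ℤ.+ x ∣                  ≤⟨ ℤ.∣i+j∣≤∣i∣+∣j∣ (+ r) x ⟩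
  r ℕ.+ ∣ x ∣                    ≤⟨ ℕ.+-mono-≤ (ℕ.<⇒≤ (ℤ.n%ℕd<d (ℤ.- x) d)) ∣x∣≤dK ⟩
  d ℕ.+ d ℕ.* K                  ≡⟨ ℕ.*-suc d K ⟨
  d ℕ.* suc K                    ∎)
  where
  open ℕ.≤-Reasoning
  q = (ℤ.- x) ℤ./ℕ d
  r = (ℤ.- x) ℤ.%ℕ d
  rearrange : ∀ q d r → d ℤ.* (ℤ.- q) ≡ r ℤ.+ (ℤ.- (r ℤ.+ q ℤ.* d))
  rearrange = ℤ-solve-∀
  d*⌈⌉ : + d ℤ.* ⌈ x / d ⌉ ≡ + r ℤ.+ x
  d*⌈⌉ = trans (rearrange q (+ d) (+ r)) (cong (ℤ._+_ (+ r))
    (trans (cong ℤ.-_ (sym (ℤ.a≡a%ℕn+[a/ℕn]*n (ℤ.- x) d))) (ℤ.neg-involutive x)))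

ceiling-≡ : ∀ q → ceiling q ≡ ⌈ ↥ q / ↧ₙ q ⌉
ceiling-≡ (mkℚ (+ 0)      d-1 _) = cong ℤ.-_ (ℤ.div-pos-is-/ℕ (+ 0) (suc d-1))
ceiling-≡ (mkℚ ℤ.+[1+ k ] d-1 _) = cong ℤ.-_ (ℤ.div-pos-is-/ℕ ℤ.-[1+ k ] (suc d-1))
ceiling-≡ (mkℚ ℤ.-[1+ k ] d-1 _) = cong ℤ.-_ (ℤ.div-pos-is-/ℕ ℤ.+[1+ k ] (suc d-1))

-- The fraction is stored in lowest terms, so the bound on `b` is first transferred to its numerator
-- by cross-multiplication, after which `t` cancels.
ceiling-/-least : ∀ {b z} t .{{_ : NonZero t}} → b ℤ.≤ + t ℤ.* z → ceiling (b ℚ./ t) ℤ.≤ z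
ceiling-/-least {b} {z} t@(suc _) b≤tz = subst (ℤ._≤ z) (sym (ceiling-≡ q))
  (⌈/⌉-least (↧ₙ q) (ℤ.*-cancelˡ-≤-pos (↥ q) (↧ q ℤ.* z) (+ t) (begin
    + t ℤ.* ↥ q            ≡⟨ ℤ.*-comm (+ t) (↥ q) ⟩
    ↥ q ℤ.* + t            ≡⟨ /-≡⁻¹ {b} {↥ q} {t} {↧ₙ q} (sym (ℚ.↥p/↧p≡p q)) ⟨
    b ℤ.* ↧ q              ≤⟨ ℤ.*-monoʳ-≤-nonNeg (↧ q) b≤tz ⟩
    + t ℤ.* z ℤ.* ↧ q      ≡⟨ rearrange (+ t) z (↧ q) ⟩
    + t ℤ.* (↧ q ℤ.* z)    ∎)))
  where
  open ℤ.≤-Reasoning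
  q = b ℚ./ t
  rearrange : ∀ t z d → t ℤ.* z ℤ.* d ≡ t ℤ.* (d ℤ.* z)
  rearrange = ℤ-solve-∀

-- Encoding sizes of rational weights and of leaves

digits-≤ : ∀ {z e} → z ℕ.≤ 2 ℕ.^ e → ⌈log₂ suc z ⌉ ℕ.≤ suc e
digits-≤ {z} {e} z≤2^e = begin
  ⌈log₂ suc z ⌉              ≤⟨ ⌈log₂⌉-mono-≤ (ℕ.+-mono-≤ (ℕ.m^n>0 2 e) (ℕ.≤-trans z≤2^e (ℕ.m≤m+n _ 0))) ⟩
  ⌈log₂ 2 ℕ.^ suc e ⌉        ≡⟨ ⌈log₂2^n⌉≡n (suc e) ⟩
  suc e                      ∎
  where open ℕ.≤-Reasoning

sizeVec-≤ : ∀ (size : A → ℕ) {c} (v : Vec A n) → (∀ i → size (lookup v i) ℕ.≤ c) →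
            sizeVec size v ℕ.≤ suc (n ℕ.* c)
sizeVec-≤ size []      bound = s≤s z≤n
sizeVec-≤ size (x ∷ v) bound = s≤s (ℕ.+-mono-≤ (bound zero) (ℕ.s≤s⁻¹ (sizeVec-≤ size v (bound ∘ suc))))

abs-factor : ∀ x {y} g → g ≢ 0 → x ℤ.* + g ≡ y → ∣ x ∣ ℕ.≤ ∣ y ∣
abs-factor x g g≢0 refl = subst (∣ x ∣ ℕ.≤_) (sym (ℤ.abs-* x (+ g))) (ℕ.m≤m*n ∣ x ∣ g {{ℕ.≢-nonZero g≢0}})

-- Reduction to lowest terms divides numerator and denominator by their gcd, so neither grows.
sizeℚ-≤ : ∀ {k T e e′} .{{_ : NonZero T}} → k ℕ.≤ 2 ℕ.^ e → T ℕ.≤ 2 ℕ.^ e′ →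
          sizeℚ (+ k ℚ./ T) ℕ.≤ 3 ℕ.+ e ℕ.+ e′
sizeℚ-≤ {k} {T} {e} {e′} k≤ T≤ = begin
  1 ℕ.+ ⌈log₂ suc ∣ ↥ q ∣ ⌉ ℕ.+ ⌈log₂ suc (↧ₙ q) ⌉
    ≤⟨ ℕ.+-mono-≤ (s≤s (digits-≤ {e = e} (ℕ.≤-trans (abs-factor (↥ q) g g≢0 (ℚ.↥-/ (+ k) T)) k≤)))
                  (digits-≤ {e = e′} (ℕ.≤-trans (abs-factor (↧ q) g g≢0 (ℚ.↧-/ (+ k) T)) T≤)) ⟩
  1 ℕ.+ suc e ℕ.+ suc e′
    ≡⟨ ℕ.+-suc (2 ℕ.+ e) e′ ⟩
  3 ℕ.+ e ℕ.+ e′ ∎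
  where
  open ℕ.≤-Reasoning
  q = + k ℚ./ T
  g = gcd k T
  g≢0 = gcd[m,n]≢0 k T (inj₂ (ℕ.≢-nonZero⁻¹ T))

coeff : Fin n → Inequality n → ℤ
coeff j I = lookup (coeffs I) j

FarkasCertificate : System n → ℕ → Set
FarkasCertificate Γ K = Certificate Γ coeff rhs K

positive⇒suc : ∀ {z} → 0ℤ ℤ.< z → ∃[ t ] z ≡ + suc t
positive⇒suc (ℤ.+<+ (s≤s {n = t} _)) = t , refl

-- Dividing all multiplicities by the positive value `T` of the combined right-hand side turns that
-- value into exactly 1. The last hypothesis is what bounds `T`, the denominator of the weights.
certificate⇒conic : ∀ {Γ : System n} {K} e e′ → FarkasCertificate Γ K → K ℕ.≤ 2 ℕ.^ e →
  (∀ {w : Weights Γ} → (∀ i → w i ℕ.≤ K) → ∣ comb Γ w rhs ∣ ℕ.≤ 2 ℕ.^ e′) →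
  Σ[ κ ∈ ConicCombination Γ 0≥1 ] sizeVec sizeℚ (weights κ) ℕ.≤ suc (length Γ ℕ.* (3 ℕ.+ e ℕ.+ e′))
certificate⇒conic {Γ = Γ} e e′ (certificate N bounded vanishes positive) K≤ rhs≤
  with t , eq ← positive⇒suc positive = κ , sizeVec-≤ sizeℚ qs λ i →
    subst (λ q → sizeℚ q ℕ.≤ 3 ℕ.+ e ℕ.+ e′) (sym (Vec.lookup∘tabulate _ i))
      (sizeℚ-≤ {N i} {T} {e} {e′} (ℕ.≤-trans (bounded i) K≤) (subst (ℕ._≤ 2 ℕ.^ e′) (cong ∣_∣ eq) (rhs≤ bounded)))
  where
  T = suc t
  qs : Vec ℚ (length Γ)
  qs = tabulate λ i → + N i ℚ./ T
  κ : ConicCombination Γ 0≥1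
  κ = record
    { weights     = qs
    ; nonneg      = VecAll.tabulate⁺ λ i → ℚ.nonNegative⁻¹ (+ N i ℚ./ T) {{ℚ.normalize-nonNeg (N i) T}}
    ; coeffs-comb = λ j → trans (weightedSum-tabulate T Γ N (coeff j)) (trans
        (/-≡ {comb Γ N (coeff j)} {0ℤ} {T} {1} (cong (ℤ._* 1ℤ) (vanishes j)))
        (cong toℚ (sym (Vec.lookup-replicate j 0ℤ))))
    ; rhs-comb    = trans (weightedSum-tabulate T Γ N rhs) (/-≡ {comb Γ N rhs} {1ℤ} {T} {1}
        (trans (ℤ.*-identityʳ _) (trans eq (sym (ℤ.*-identityˡ (+ T))))))
    }

-- Derivable inequalities

-- The coefficients must match exactly, whereas the right-hand side may be stronger: the cut
-- replacing a division can give more than the rounded inequality.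
record Derivable (Γ : System n) (I : Inequality n) : Set where
  constructor derivable
  field
    scale         : ℕ
    {{scale≢0}}   : NonZero scale
    multiplicity  : Weights Γ
    coeffs-eq     : ∀ j → comb Γ multiplicity (coeff j) ≡ + scale ℤ.* coeff j I
    rhs-≤         : + scale ℤ.* rhs I ℤ.≤ comb Γ multiplicity rhs

unit : ∀ {Γ : List A} {x} → x ∈ Γ → Weights Γ
unit (here _)  zero    = 1
unit (here _)  (suc _) = 0
unit (there p) zero    = 0
unit (there p) (suc i) = unit p i

comb-zero : (Γ : List A) (f : A → ℤ) → comb Γ (λ _ → 0) f ≡ 0ℤ
comb-zero []      f = refl
comb-zero (x ∷ Γ) f = trans (ℤ.+-identityˡ _) (comb-zero Γ f)

comb-unit : ∀ {Γ : List A} {x} (p : x ∈ Γ) f → comb Γ (unit p) f ≡ f x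
comb-unit {Γ = _ ∷ Γ} {x} (here refl) f = trans (cong₂ ℤ._+_ (ℤ.*-identityˡ (f x)) (comb-zero Γ f)) (ℤ.+-identityʳ (f x))
comb-unit (there p) f = trans (ℤ.+-identityˡ _) (comb-unit p f)

member-derivable : ∀ {Γ : System n} {I} → I ∈ Γ → Derivable Γ I
member-derivable {I = I} p = derivable 1 (unit p)
  (λ j → trans (comb-unit p (coeff j)) (sym (ℤ.*-identityˡ (coeff j I))))
  (ℤ.≤-reflexive (trans (ℤ.*-identityˡ (rhs I)) (sym (comb-unit p rhs))))

-- A query puts its label at the head of the path, which is a position in the middle of `S ++ P`;
-- hence the insertion after a prefix.
insert : ∀ (Δ : List A) {Γ x} → ℕ → Weights (Δ ++ Γ) → Weights (Δ ++ x ∷ Γ)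
insert []      k w zero    = k
insert []      k w (suc i) = w i
insert (_ ∷ Δ) k w zero    = w zero
insert (_ ∷ Δ) k w (suc i) = insert Δ k (w ∘ suc) i

comb-insert : ∀ (Δ : List A) {Γ x} k (w : Weights (Δ ++ Γ)) f →
              comb (Δ ++ x ∷ Γ) (insert Δ k w) f ≡ comb (Δ ++ Γ) w f ℤ.+ + k ℤ.* f x
comb-insert []          k w f = ℤ.+-comm (+ k ℤ.* f _) _
comb-insert (y ∷ Δ) {x = x} k w f = trans
  (cong (ℤ._+_ (+ w zero ℤ.* f y)) (comb-insert Δ k (w ∘ suc) f))
  (sym (ℤ.+-assoc (+ w zero ℤ.* f y) _ (+ k ℤ.* f x)))

insert-≤ : ∀ (Δ : List A) {Γ x k K} {w : Weights (Δ ++ Γ)} → k ℕ.≤ K → (∀ i → w i ℕ.≤ K) →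
           ∀ i → insert Δ {Γ} {x} k w i ℕ.≤ K
insert-≤ []      k≤K w≤K zero    = k≤K
insert-≤ []      k≤K w≤K (suc i) = w≤K i
insert-≤ (_ ∷ Δ) k≤K w≤K zero    = w≤K zero
insert-≤ (_ ∷ Δ) k≤K w≤K (suc i) = insert-≤ Δ k≤K (w≤K ∘ suc) i

weaken : ∀ (Δ : System n) {Γ I J} → Derivable (Δ ++ Γ) I → Derivable (Δ ++ J ∷ Γ) I
weaken Δ {Γ} {J = J} (derivable D w coeffs-eq rhs-≤) = derivable D (insert Δ 0 w)
  (λ j → trans (unchanged (coeff j)) (coeffs-eq j))
  (ℤ.≤-trans rhs-≤ (ℤ.≤-reflexive (sym (unchanged rhs))))
  where
  unchanged : ∀ f → comb (Δ ++ J ∷ Γ) (insert Δ 0 w) f ≡ comb (Δ ++ Γ) w f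
  unchanged f = trans (comb-insert Δ 0 w f) (ℤ.+-identityʳ _)

record CommonMultiple (Γ Δ : System n) (u : Weights Δ) : Set where
  constructor commonMultiple
  field
    scale         : ℕ
    {{scale≢0}}   : NonZero scale
    multiplicity  : Weights Γ
    coeffs-eq     : ∀ j → comb Γ multiplicity (coeff j) ≡ + scale ℤ.* comb Δ u (coeff j)
    rhs-≤         : + scale ℤ.* comb Δ u rhs ℤ.≤ comb Γ multiplicity rhs

-- If the head is derived at scale `D` and the tail at scale `E`, taking the head derivation E u₀
-- times and the tail derivation `D` times brings both to scale D E.
combine-derivations : ∀ {Γ Δ : System n} → ListAll.All (Derivable Γ) Δ → ∀ u → CommonMultiple Γ Δ u
combine-derivations {Γ = Γ} [] u = commonMultiple 1 (λ _ → 0)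
  (λ j → comb-zero Γ (coeff j)) (ℤ.≤-reflexive (sym (comb-zero Γ rhs)))
combine-derivations {Γ = Γ} {x ∷ Δ} (derivable D v v-eq v-≤ ∷ ds) u
  with commonMultiple E w w-eq w-≤ ← combine-derivations ds (u ∘ suc) = commonMultiple (D ℕ.* E) {{ℕ.m*n≢0 D E}} s
    (λ j → trans (sym (expand (coeff j))) (trans (cong₂ (λ y z → + p ℤ.* y ℤ.+ + D ℤ.* z) (v-eq j) (w-eq j)) (collect (coeff j))))
    (begin
      + (D ℕ.* E) ℤ.* comb (x ∷ Δ) u rhs   ≡⟨ collect rhs ⟨
      + p ℤ.* (+ D ℤ.* rhs x) ℤ.+ + D ℤ.* (+ E ℤ.* comb Δ (u ∘ suc) rhs)
        ≤⟨ ℤ.+-mono-≤ (ℤ.*-monoˡ-≤-nonNeg (+ p) v-≤) (ℤ.*-monoˡ-≤-nonNeg (+ D) w-≤) ⟩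
      + p ℤ.* comb Γ v rhs ℤ.+ + D ℤ.* comb Γ w rhs  ≡⟨ expand rhs ⟩
      comb Γ s rhs ∎)
  where
  open ℤ.≤-Reasoning
  p = E ℕ.* u zero
  s : Weights Γ
  s i = p ℕ.* v i ℕ.+ D ℕ.* w i
  expand : ∀ f → + p ℤ.* comb Γ v f ℤ.+ + D ℤ.* comb Γ w f ≡ comb Γ s f
  expand f = comb-linear p D Γ f λ _ → refl
  rearrange : ∀ e u d y z → e ℤ.* u ℤ.* (d ℤ.* y) ℤ.+ d ℤ.* (e ℤ.* z) ≡ d ℤ.* e ℤ.* (u ℤ.* y ℤ.+ z)
  rearrange = ℤ-solve-∀
  collect : ∀ f → + p ℤ.* (+ D ℤ.* f x) ℤ.+ + D ℤ.* (+ E ℤ.* comb Δ (u ∘ suc) f) ≡ + (D ℕ.* E) ℤ.* comb (x ∷ Δ) u f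
  collect f = trans
    (cong (λ c → c ℤ.* (+ D ℤ.* f x) ℤ.+ + D ℤ.* (+ E ℤ.* comb Δ (u ∘ suc) f)) (ℤ.pos-* E (u zero)))
    (trans (rearrange (+ E) (+ u zero) (+ D) (f x) (comb Δ (u ∘ suc) f))
           (cong (ℤ._* comb (x ∷ Δ) u f) (sym (ℤ.pos-* D E))))

-- The derivations of the premises are substituted into the combination after clearing denominators.
-- A conic step therefore costs no query.
conic-derivable : ∀ {Γ Δ : System n} {I} → ListAll.All (Derivable Γ) Δ → ConicCombination Δ I → Derivable Γ I
conic-derivable {Γ = Γ} {Δ} {I} ds κ
  with integerWeights D u u-eq ← clear-denominators Δ (weights κ) (nonneg κ)
  with commonMultiple E w w-eq w-≤ ← combine-derivations ds u
  = derivable (E ℕ.* D) {{ℕ.m*n≢0 E D}} w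
    (λ j → trans (w-eq j) (scaled (coeff j) (coeffs-comb κ j)))
    (subst (ℤ._≤ comb Γ w rhs) (scaled rhs (rhs-comb κ)) w-≤)
  where
  scaled : ∀ f → weightedSum Δ (weights κ) f ≡ toℚ (f I) → + E ℤ.* comb Δ u f ≡ + (E ℕ.* D) ℤ.* f I
  scaled f eq = trans (cong (ℤ._*_ (+ E)) (trans (sym (ℤ.*-identityʳ _)) (trans
      (/-≡⁻¹ {comb Δ u f} {f I} {D} {1} (trans (sym (u-eq f)) eq)) (ℤ.*-comm (f I) (+ D)))))
    (trans (sym (ℤ.*-assoc (+ E) (+ D) (f I))) (cong (ℤ._* f I) (sym (ℤ.pos-* E D))))

-- Cuts replacing division steps

record Bounded (B : ℕ) (I : Inequality n) : Set where
  constructor bounds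
  field
    coeff-≤ : ∀ j → ∣ coeff j I ∣ ℕ.≤ B
    rhs-≤   : ∣ rhs I ∣ ℕ.≤ B

Bounded-mono : ∀ {B C} {I : Inequality n} → B ℕ.≤ C → Bounded B I → Bounded C I
Bounded-mono B≤C (bounds c r) = bounds (λ j → ℕ.≤-trans (c j) B≤C) (ℕ.≤-trans r B≤C)

-- `refuted` closes the left branch of the query and `implies` continues the right one.
-- `witness-bound` is left free because the certificate is shrunk later; the extra one in the bound
-- on the cut pays for rounding `d`.
record DivisionCut (S P : System n) (B : ℕ) (I : Inequality n) : Set where
  constructor divisionCut
  field
    {witness-bound} : ℕ
    c        : Vec ℤ n
    d        : ℤ
    bounded  : Bounded (suc (length (S ++ P) ℕ.* B)) (c ·x≥ d)
    refuted  : FarkasCertificate (S ++ (c ·x≤ (d ℤ.- 1ℤ)) ∷ P) witness-bound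
    implies  : Derivable (S ++ (c ·x≥ d) ∷ P) I

-- Since D a = Σ Nᵢ aᵢ, the vector a/t has weights Nᵢ/E with E = D t. Writing Nᵢ = E qᵢ + rᵢ
-- separates an integral part, which is added back without a query, from the weights rᵢ/E < 1, to
-- which alone the cut is applied.
divide : ∀ {S P : System n} {B a a/t b} t .{{_ : NonZero t}} → ListAll.All (Bounded B) (S ++ P) →
         a ≡ Vec.map (+ t ℤ.*_) a/t → Derivable (S ++ P) (a ·x≥ b) →
         DivisionCut S P B (a/t ·x≥ ceiling (b ℚ./ t))
divide {n = n} {S} {P} {B} {a} {a/t} {b} t {{t≢0}} B≤ a≡ (derivable D N N-eq N-≤) =
  divisionCut c d (bounds c-bound d-bound)
    (certificate (insert S E r) (insert-≤ S ℕ.≤-refl λ i → ℕ.m%n≤n (N i) E) vanishes positive)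
    (derivable 1 (insert S 1 q) implied-coeffs implied-rhs)
  where
  Γ = S ++ P
  E = D ℕ.* t
  instance E≢0 = ℕ.m*n≢0 D t
  q r : Weights Γ
  q i = N i ℕ./ E
  r i = N i ℕ.% E
  -- Defined by subtraction, `c` is visibly integral; its entries are small because E c = Σ rᵢ aᵢ
  -- with rᵢ < E.
  c : Vec ℤ n
  c = tabulate λ j → lookup a/t j ℤ.- comb Γ q (coeff j)
  d : ℤ
  d = ⌈ comb Γ r rhs / E ⌉

  integral+fractional : ∀ f → + E ℤ.* comb Γ q f ℤ.+ comb Γ r f ≡ comb Γ N f
  integral+fractional f = trans
    (cong (ℤ._+_ (+ E ℤ.* comb Γ q f)) (sym (ℤ.*-identityˡ (comb Γ r f))))
    (comb-linear E 1 Γ f λ i → trans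
      (trans (ℕ.+-comm (E ℕ.* q i) (1 ℕ.* r i)) (cong₂ ℕ._+_ (ℕ.*-identityˡ (r i)) (ℕ.*-comm E (q i))))
      (sym (ℕ.m≡m%n+[m/n]*n (N i) E)))

  E*c : ∀ j → + E ℤ.* lookup c j ≡ comb Γ r (coeff j)
  E*c j = begin
    + E ℤ.* lookup c j                                            ≡⟨ cong (ℤ._*_ (+ E)) (Vec.lookup∘tabulate _ j) ⟩
    + E ℤ.* (lookup a/t j ℤ.- Q)                                  ≡⟨ cong (ℤ._* (lookup a/t j ℤ.- Q)) (ℤ.pos-* D t) ⟩
    + D ℤ.* + t ℤ.* (lookup a/t j ℤ.- Q)                          ≡⟨ rearrange (+ D) (+ t) (lookup a/t j) Q ⟩
    + D ℤ.* (+ t ℤ.* lookup a/t j) ℤ.- + D ℤ.* + t ℤ.* Q          ≡⟨ cong₂ (λ x e → + D ℤ.* x ℤ.- e ℤ.* Q) a-j (ℤ.pos-* D t) ⟨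
    + D ℤ.* lookup a j ℤ.- + E ℤ.* Q                              ≡⟨ cong (ℤ._- + E ℤ.* Q) (trans (integral+fractional (coeff j)) (N-eq j)) ⟨
    + E ℤ.* Q ℤ.+ comb Γ r (coeff j) ℤ.- + E ℤ.* Q                ≡⟨ cancel (+ E ℤ.* Q) (comb Γ r (coeff j)) ⟩
    comb Γ r (coeff j)                                            ∎
    where
    open ≡-Reasoning
    Q = comb Γ q (coeff j)
    a-j : lookup a j ≡ + t ℤ.* lookup a/t j
    a-j = trans (cong (λ v → lookup v j) a≡) (Vec.lookup-map j (+ t ℤ.*_) a/t)
    rearrange : ∀ D t x q → D ℤ.* t ℤ.* (x ℤ.- q) ≡ D ℤ.* (t ℤ.* x) ℤ.- D ℤ.* t ℤ.* q
    rearrange = ℤ-solve-∀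
    cancel : ∀ x y → x ℤ.+ y ℤ.- x ≡ y
    cancel = ℤ-solve-∀

  r-bound : ∀ {f} → ListAll.All (λ I → ∣ f I ∣ ℕ.≤ B) Γ → ∣ comb Γ r f ∣ ℕ.≤ E ℕ.* (length Γ ℕ.* B)
  r-bound small = ℕ.≤-trans (comb-bound Γ (λ i → ℕ.m%n≤n (N i) E) small) (ℕ.≤-reflexive (rearrange (length Γ) E B))
    where
    rearrange : ∀ m e b → m ℕ.* (e ℕ.* b) ≡ e ℕ.* (m ℕ.* b)
    rearrange = ℕ-solve-∀

  c-bound : ∀ j → ∣ lookup c j ∣ ℕ.≤ suc (length Γ ℕ.* B)
  c-bound j = ℕ.m≤n⇒m≤1+n (ℕ.*-cancelˡ-≤ E (begin
    E ℕ.* ∣ lookup c j ∣        ≡⟨ ℤ.abs-* (+ E) (lookup c j) ⟨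
    ∣ + E ℤ.* lookup c j ∣      ≡⟨ cong ∣_∣ (E*c j) ⟩
    ∣ comb Γ r (coeff j) ∣      ≤⟨ r-bound (ListAll.map (λ β → Bounded.coeff-≤ β j) B≤) ⟩
    E ℕ.* (length Γ ℕ.* B)      ∎))
    where open ℕ.≤-Reasoning

  d-bound : ∣ d ∣ ℕ.≤ suc (length Γ ℕ.* B)
  d-bound = ⌈/⌉-bound (comb Γ r rhs) E (r-bound (ListAll.map Bounded.rhs-≤ B≤))

  -- `E` copies of the violated cut cancel Σ rᵢ aᵢ = E c. On the right-hand side Σ rᵢ bᵢ - E (d - 1)
  -- remains, positive because `d` is the rounded-up quotient.
  vanishes : ∀ j → comb (S ++ (c ·x≤ (d ℤ.- 1ℤ)) ∷ P) (insert S E r) (coeff j) ≡ 0ℤ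
  vanishes j = begin
    comb (S ++ (c ·x≤ (d ℤ.- 1ℤ)) ∷ P) (insert S E r) (coeff j)   ≡⟨ comb-insert S E r (coeff j) ⟩
    comb Γ r (coeff j) ℤ.+ + E ℤ.* lookup (Vec.map ℤ.-_ c) j      ≡⟨ cong₂ (λ x y → x ℤ.+ + E ℤ.* y) (sym (E*c j)) (Vec.lookup-map j ℤ.-_ c) ⟩
    + E ℤ.* lookup c j ℤ.+ + E ℤ.* (ℤ.- lookup c j)               ≡⟨ cancel (+ E) (lookup c j) ⟩
    0ℤ                                                            ∎
    where
    open ≡-Reasoning
    cancel : ∀ e x → e ℤ.* x ℤ.+ e ℤ.* (ℤ.- x) ≡ 0ℤ
    cancel = ℤ-solve-∀

  positive : 0ℤ ℤ.< comb (S ++ (c ·x≤ (d ℤ.- 1ℤ)) ∷ P) (insert S E r) rhs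
  positive = begin-strict
    0ℤ                                                            ≡⟨ cancel (+ E) (d ℤ.- 1ℤ) ⟨
    + E ℤ.* (d ℤ.- 1ℤ) ℤ.+ + E ℤ.* (ℤ.- (d ℤ.- 1ℤ))               <⟨ ℤ.+-monoˡ-< _ (⌈/⌉-upper (comb Γ r rhs) E) ⟩
    comb Γ r rhs ℤ.+ + E ℤ.* (ℤ.- (d ℤ.- 1ℤ))                     ≡⟨ comb-insert S E r rhs ⟨
    comb (S ++ (c ·x≤ (d ℤ.- 1ℤ)) ∷ P) (insert S E r) rhs         ∎
    where
    open ℤ.≤-Reasoning
    cancel : ∀ e x → e ℤ.* x ℤ.+ e ℤ.* (ℤ.- x) ≡ 0ℤ
    cancel = ℤ-solve-∀

  implied-coeffs : ∀ j → comb (S ++ (c ·x≥ d) ∷ P) (insert S 1 q) (coeff j) ≡ 1ℤ ℤ.* lookup a/t j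
  implied-coeffs j = trans (comb-insert S 1 q (coeff j)) (trans
    (cong (λ x → comb Γ q (coeff j) ℤ.+ 1ℤ ℤ.* x) (Vec.lookup∘tabulate _ j))
    (restore (comb Γ q (coeff j)) (lookup a/t j)))
    where
    restore : ∀ x y → x ℤ.+ 1ℤ ℤ.* (y ℤ.- x) ≡ 1ℤ ℤ.* y
    restore = ℤ-solve-∀

  -- Rounding up the fractional part gives D b ≤ E (Σ qᵢ bᵢ + d). Cancelling `D` leaves `t` times an
  -- integer, and that integer is then at least the ceiling of b/t.
  b≤ : b ℤ.≤ + t ℤ.* (comb Γ q rhs ℤ.+ d)
  b≤ = ℤ.*-cancelˡ-≤-pos b _ (+ D) {{ℤ.positive (ℤ.+<+ (ℕ.>-nonZero⁻¹ D))}} (begin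
    + D ℤ.* b                                        ≤⟨ N-≤ ⟩
    comb Γ N rhs                                     ≡⟨ integral+fractional rhs ⟨
    + E ℤ.* comb Γ q rhs ℤ.+ comb Γ r rhs            ≤⟨ ℤ.+-monoʳ-≤ (+ E ℤ.* comb Γ q rhs) (⌈/⌉-lower (comb Γ r rhs) E) ⟩
    + E ℤ.* comb Γ q rhs ℤ.+ + E ℤ.* d               ≡⟨ cong (λ e → e ℤ.* comb Γ q rhs ℤ.+ e ℤ.* d) (ℤ.pos-* D t) ⟩
    + D ℤ.* + t ℤ.* comb Γ q rhs ℤ.+ + D ℤ.* + t ℤ.* d ≡⟨ rearrange (+ D) (+ t) (comb Γ q rhs) d ⟩
    + D ℤ.* (+ t ℤ.* (comb Γ q rhs ℤ.+ d))           ∎)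
    where
    open ℤ.≤-Reasoning
    rearrange : ∀ D t x y → D ℤ.* t ℤ.* x ℤ.+ D ℤ.* t ℤ.* y ≡ D ℤ.* (t ℤ.* (x ℤ.+ y))
    rearrange = ℤ-solve-∀

  implied-rhs : 1ℤ ℤ.* ceiling (b ℚ./ t) ℤ.≤ comb (S ++ (c ·x≥ d) ∷ P) (insert S 1 q) rhs
  implied-rhs = begin
    1ℤ ℤ.* ceiling (b ℚ./ t)                          ≡⟨ ℤ.*-identityˡ _ ⟩
    ceiling (b ℚ./ t)                                 ≤⟨ ceiling-/-least t b≤ ⟩
    comb Γ q rhs ℤ.+ d                                ≡⟨ cong (ℤ._+_ (comb Γ q rhs)) (ℤ.*-identityˡ d) ⟨
    comb Γ q rhs ℤ.+ 1ℤ ℤ.* d                         ≡⟨ comb-insert S 1 q rhs ⟨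
    comb (S ++ (c ·x≥ d) ∷ P) (insert S 1 q) rhs      ∎
    where open ℤ.≤-Reasoning

-- Bit-lengths

n<2^n : ∀ k → k ℕ.< 2 ℕ.^ k
n<2^n zero    = s≤s z≤n
n<2^n (suc k) = ℕ.+-mono-≤ (ℕ.m^n>0 2 k) (ℕ.≤-trans (n<2^n k) (ℕ.m≤m+n _ 0))

≤2^-from-⌈log₂⌉ : ∀ e k → ⌈log₂ k ⌉ ℕ.≤ e → k ℕ.≤ 2 ℕ.^ e
≤2^-from-⌈log₂⌉ zero    zero          _ = z≤n
≤2^-from-⌈log₂⌉ zero    (suc zero)    _ = s≤s z≤n
≤2^-from-⌈log₂⌉ zero    (suc (suc k)) log≤0 =
  contradiction (ℕ.≤-trans (⌈log₂⌉-mono-≤ {2} {2 ℕ.+ k} (s≤s (s≤s z≤n))) log≤0) λ ()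
≤2^-from-⌈log₂⌉ (suc e) k log≤1+e = begin
  k                              ≡⟨ ℕ.⌊n/2⌋+⌈n/2⌉≡n k ⟨
  ℕ.⌊ k /2⌋ ℕ.+ ℕ.⌈ k /2⌉        ≤⟨ ℕ.+-mono-≤ (ℕ.≤-trans (ℕ.⌊n/2⌋≤⌈n/2⌉ k) half) half ⟩
  2 ℕ.^ e ℕ.+ 2 ℕ.^ e            ≡⟨ cong (2 ℕ.^ e ℕ.+_) (ℕ.+-identityʳ _) ⟨
  2 ℕ.^ suc e                    ∎
  where
  open ℕ.≤-Reasoning
  half : ℕ.⌈ k /2⌉ ℕ.≤ 2 ℕ.^ e
  half = ≤2^-from-⌈log₂⌉ e ℕ.⌈ k /2⌉ (subst (ℕ._≤ e) (sym (⌈log₂⌈n/2⌉⌉≡⌈log₂n⌉∸1 k)) (ℕ.∸-monoˡ-≤ 1 log≤1+e))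

sizeℤ⇒≤2^ : ∀ z {e} → sizeℤ z ℕ.≤ e → ∣ z ∣ ℕ.≤ 2 ℕ.^ e
sizeℤ⇒≤2^ z {e} size≤e = ℕ.≤-trans (ℕ.n≤1+n ∣ z ∣)
  (≤2^-from-⌈log₂⌉ e (suc ∣ z ∣) (ℕ.≤-trans (ℕ.n≤1+n _) size≤e))

lookup-sizeVec : ∀ (size : A → ℕ) (v : Vec A n) i → size (lookup v i) ℕ.≤ sizeVec size v
lookup-sizeVec size (x ∷ v) zero    = ℕ.m≤n⇒m≤1+n (ℕ.m≤m+n (size x) _)
lookup-sizeVec size (x ∷ v) (suc i) = ℕ.≤-trans (lookup-sizeVec size v i) (s≤s (ℕ.m≤n+m _ (size x)))

length<sizeVec : (v : Vec ℤ n) → n ℕ.< sizeVec sizeℤ v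
length<sizeVec []      = s≤s z≤n
length<sizeVec (z ∷ v) = s≤s (ℕ.+-mono-≤ (s≤s z≤n) (ℕ.s≤s⁻¹ (length<sizeVec v)))

length<sizeSystem : (S : System n) → length S ℕ.< sizeSystem S
length<sizeSystem []      = s≤s z≤n
length<sizeSystem (I ∷ S) = s≤s (ℕ.+-mono-≤ (s≤s z≤n) (ℕ.s≤s⁻¹ (length<sizeSystem S)))

sizeInequality≤sizeSystem : (S : System n) → ListAll.All (λ I → sizeInequality I ℕ.≤ sizeSystem S) S
sizeInequality≤sizeSystem []      = []
sizeInequality≤sizeSystem (I ∷ S) = ℕ.m≤n⇒m≤1+n (ℕ.m≤m+n (sizeInequality I) _)
  ∷ ListAll.map (λ le → ℕ.≤-trans le (s≤s (ℕ.m≤n+m _ (sizeInequality I)))) (sizeInequality≤sizeSystem S)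

sizeInequality⇒Bounded : ∀ {I : Inequality n} {e} → sizeInequality I ℕ.≤ e → Bounded (2 ℕ.^ e) I
sizeInequality⇒Bounded {I = a ·x≥ b} size≤e = bounds
  (λ j → sizeℤ⇒≤2^ (lookup a j) (ℕ.≤-trans (lookup-sizeVec sizeℤ a j) (ℕ.m+n≤o⇒m≤o _ size≤e)))
  (sizeℤ⇒≤2^ b (ℕ.m+n≤o⇒n≤o (sizeVec sizeℤ a) size≤e))

-- The empty system is satisfied by the zero vector, so there is an inequality, whose encoding
-- spends at least one bit on each variable.
unsatisfiable⇒variables≤size : (S : System n) → Unsatisfiable S → n ℕ.≤ sizeSystem S
unsatisfiable⇒variables≤size [] unsat = contradiction (replicate _ 0ℤ , []) unsat
unsatisfiable⇒variables≤size S@((a ·x≥ b) ∷ _) _ = ℕ.≤-trans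
  (ℕ.<⇒≤ (ℕ.<-≤-trans (length<sizeVec a) (ℕ.m≤m+n _ (sizeℤ b))))
  (ListAll.head (sizeInequality≤sizeSystem S))

weights-bounded : (Γ : List A) (w : Weights Γ) → ∃[ K ] (∀ i → w i ℕ.≤ K)
weights-bounded []      w = 0 , λ ()
weights-bounded (x ∷ Γ) w with K , w≤K ← weights-bounded Γ (w ∘ suc) = w zero ℕ.+ K , λ where
  zero    → ℕ.m≤m+n (w zero) K
  (suc i) → ℕ.≤-trans (w≤K i) (ℕ.m≤n+m K (w zero))

0≥1-certificate : ∀ {Γ : System n} → Derivable Γ 0≥1 → ∃[ K ] FarkasCertificate Γ K
0≥1-certificate {Γ = Γ} (derivable D w w-eq w-≤) with K , w≤K ← weights-bounded Γ w = K , certificate w w≤K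
  (λ j → trans (w-eq j) (trans (cong (ℤ._*_ (+ D)) (Vec.lookup-replicate j 0ℤ)) (ℤ.*-zeroʳ (+ D))))
  (ℤ.<-≤-trans (subst (0ℤ ℤ.<_) (sym (ℤ.*-identityʳ (+ D))) (ℤ.+<+ (ℕ.>-nonZero⁻¹ D))) w-≤)

-- `X` stands for s + L. The first two are exponents of 2, bounding the entries of labels and the
-- multiplicities of shrunk certificates. `entryDigits` has one digit to spare for d - 1, and
-- `querySize` charges both edges and the closed left leaf.
entryDigits boxDigits weightSize labelSize leafSize querySize : ℕ → ℕ
entryDigits X = suc (X ℕ.* suc X)
boxDigits   X = (2 ℕ.+ (X ℕ.+ entryDigits X)) ℕ.* X
weightSize  X = 3 ℕ.+ boxDigits X ℕ.+ (X ℕ.+ (boxDigits X ℕ.+ entryDigits X))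
labelSize   X = suc (X ℕ.* (2 ℕ.+ entryDigits X)) ℕ.+ (2 ℕ.+ entryDigits X)
leafSize    X = 2 ℕ.+ X ℕ.* weightSize X
querySize   X = 1 ℕ.+ labelSize X ℕ.+ labelSize X ℕ.+ leafSize X

*-≤2^ : ∀ {x y} a b → x ℕ.≤ 2 ℕ.^ a → y ℕ.≤ 2 ℕ.^ b → x ℕ.* y ℕ.≤ 2 ℕ.^ (a ℕ.+ b)
*-≤2^ a b x≤ y≤ = ℕ.≤-trans (ℕ.*-mono-≤ x≤ y≤) (ℕ.≤-reflexive (sym (ℕ.^-distribˡ-+-* 2 a b)))

boxSide-≤2^ : ∀ {y} a → y ℕ.≤ 2 ℕ.^ a → suc (y ℕ.+ y) ℕ.≤ 2 ℕ.^ (2 ℕ.+ a)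
boxSide-≤2^ {y} a y≤ = begin
  1 ℕ.+ (y ℕ.+ y)                      ≤⟨ ℕ.+-mono-≤ (ℕ.m^n>0 2 a) (ℕ.+-mono-≤ y≤ y≤) ⟩
  2^a ℕ.+ (2^a ℕ.+ 2^a)                ≤⟨ ℕ.m≤m+n _ 2^a ⟩
  2^a ℕ.+ (2^a ℕ.+ 2^a) ℕ.+ 2^a        ≡⟨ rearrange 2^a ⟩
  2 ℕ.^ (2 ℕ.+ a)                      ∎
  where
  open ℕ.≤-Reasoning
  2^a = 2 ℕ.^ a
  rearrange : ∀ x → x ℕ.+ (x ℕ.+ x) ℕ.+ x ≡ 2 ℕ.* (2 ℕ.* x)
  rearrange = ℕ-solve-∀

query-size : ∀ X {l m o} x k → l ℕ.≤ labelSize X → m ℕ.≤ labelSize X → o ℕ.≤ leafSize X →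
             1 ℕ.+ l ℕ.+ m ℕ.+ o ℕ.+ x ℕ.+ k ℕ.* querySize X ℕ.≤ x ℕ.+ suc k ℕ.* querySize X
query-size X x k l≤ m≤ o≤ = ℕ.≤-trans
  (ℕ.+-monoˡ-≤ _ (ℕ.+-monoˡ-≤ x (ℕ.+-mono-≤ (ℕ.+-mono-≤ (s≤s l≤) m≤) o≤)))
  (ℕ.≤-reflexive (rearrange (querySize X) x k))
  where
  rearrange : ∀ q x k → q ℕ.+ x ℕ.+ k ℕ.* q ≡ x ℕ.+ (q ℕ.+ k ℕ.* q)
  rearrange = ℕ-solve-∀

module _ {n X : ℕ} (n≤X : n ℕ.≤ X) where

  private
    E = entryDigits X
    V = boxDigits X

  ≤X⇒≤2^X : ∀ {m} → m ℕ.≤ X → m ℕ.≤ 2 ℕ.^ X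
  ≤X⇒≤2^X m≤X = ℕ.≤-trans m≤X (ℕ.<⇒≤ (n<2^n X))

  labelSize-bound : {I : Inequality n} → Bounded (2 ℕ.^ E) I → sizeInequality I ℕ.≤ labelSize X
  labelSize-bound {a ·x≥ b} (bounds c r) = ℕ.+-mono-≤
    (ℕ.≤-trans (sizeVec-≤ sizeℤ a λ j → s≤s (digits-≤ {e = E} (c j)))
               (s≤s (ℕ.*-monoˡ-≤ (2 ℕ.+ E) n≤X)))
    (s≤s (digits-≤ {e = E} r))

  -- However large `K` is, shrinking leaves multiplicities at most 2^V, and the denominator obtained
  -- from the right-hand sides is then at most 2^(X + V + E).
  small-leaf : ∀ {S P : System n} {K} → length (S ++ P) ℕ.≤ X → ListAll.All (Bounded (2 ℕ.^ E)) (S ++ P) →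
               FarkasCertificate (S ++ P) K → Σ[ κ ∈ ConicCombination (S ++ P) 0≥1 ] sizeSP {P = P} (leaf κ) ℕ.≤ leafSize X
  small-leaf {S} {P} len≤X entries C =
    let κ , size≤ = certificate⇒conic V (X ℕ.+ (V ℕ.+ E))
                      (small-certificate Γ coeff rhs (2 ℕ.^ E) (λ j → ListAll.map (λ β → Bounded.coeff-≤ β j) entries) C)
                      boxes≤ rhs≤
    in κ , s≤s (ℕ.≤-trans size≤ (s≤s (ℕ.*-monoˡ-≤ (weightSize X) len≤X)))
    where
    Γ = S ++ P
    boxCount = suc (length Γ ℕ.* 2 ℕ.^ E ℕ.+ length Γ ℕ.* 2 ℕ.^ E) ℕ.^ n
    boxes≤ : boxCount ℕ.≤ 2 ℕ.^ V
    boxes≤ = begin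
      boxCount                                  ≤⟨ ℕ.^-monoˡ-≤ n (boxSide-≤2^ (X ℕ.+ E) (*-≤2^ X E (≤X⇒≤2^X len≤X) ℕ.≤-refl)) ⟩
      (2 ℕ.^ (2 ℕ.+ (X ℕ.+ E))) ℕ.^ n           ≡⟨ ℕ.^-*-assoc 2 (2 ℕ.+ (X ℕ.+ E)) n ⟩
      2 ℕ.^ ((2 ℕ.+ (X ℕ.+ E)) ℕ.* n)           ≤⟨ ℕ.^-monoʳ-≤ 2 (ℕ.*-monoʳ-≤ (2 ℕ.+ (X ℕ.+ E)) n≤X) ⟩
      2 ℕ.^ V                                   ∎
      where open ℕ.≤-Reasoning
    rhs≤ : ∀ {w : Weights Γ} → (∀ i → w i ℕ.≤ boxCount) → ∣ comb Γ w rhs ∣ ℕ.≤ 2 ℕ.^ (X ℕ.+ (V ℕ.+ E))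
    rhs≤ w≤ = ℕ.≤-trans (comb-bound Γ w≤ (ListAll.map Bounded.rhs-≤ entries))
      (*-≤2^ X (V ℕ.+ E) (≤X⇒≤2^X len≤X) (*-≤2^ V E boxes≤ ℕ.≤-refl))

  -- Simulation along the rightmost branch

  module _ (S : System n) (S-bounded : ListAll.All (Bounded (2 ℕ.^ X)) S) where

    -- A cut enlarges the entries by a factor of at most m + 1 ≤ 2^X, where m ≤ X counts the
    -- available inequalities. Each step thus adds `X` to the exponent, starting from 2^X for the
    -- system itself.
    entryBound : ℕ → ℕ
    entryBound k = 2 ℕ.^ (X ℕ.* suc k)

    entryBound-mono : ∀ {k l} → k ℕ.≤ l → entryBound k ℕ.≤ entryBound l
    entryBound-mono k≤l = ℕ.^-monoʳ-≤ 2 (ℕ.*-monoʳ-≤ X (s≤s k≤l))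

    2^X≤entryBound : ∀ k → 2 ℕ.^ X ℕ.≤ entryBound k
    2^X≤entryBound k = ℕ.^-monoʳ-≤ 2 (ℕ.m≤m*n X (suc k))

    entryBound-suc : ∀ {m} k → m ℕ.≤ X → suc (m ℕ.* entryBound k) ℕ.≤ entryBound (suc k)
    entryBound-suc {m} k m≤X = begin
      suc (m ℕ.* entryBound k)             ≤⟨ ℕ.+-monoˡ-≤ _ (ℕ.m^n>0 2 (X ℕ.* suc k)) ⟩
      suc m ℕ.* entryBound k               ≤⟨ *-≤2^ X (X ℕ.* suc k) (ℕ.≤-<-trans m≤X (n<2^n X)) ℕ.≤-refl ⟩
      2 ℕ.^ (X ℕ.+ X ℕ.* suc k)            ≡⟨ cong (2 ℕ.^_) (ℕ.*-suc X (suc k)) ⟨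
      entryBound (suc k)                   ∎
      where open ℕ.≤-Reasoning

    entryBound≤2^E : ∀ {k} → k ℕ.≤ X → entryBound k ℕ.≤ 2 ℕ.^ E
    entryBound≤2^E k≤X = ℕ.^-monoʳ-≤ 2 (ℕ.m≤n⇒m≤1+n (ℕ.*-monoʳ-≤ X (s≤s k≤X)))

    -- Passing to d - 1 at most doubles the bound, which the spare digit of `entryDigits` absorbs.
    negation-bounded : ∀ {k} {c : Vec ℤ n} {d} → k ℕ.≤ X →
                       Bounded (entryBound k) (c ·x≥ d) → Bounded (2 ℕ.^ E) (c ·x≤ (d ℤ.- 1ℤ))
    negation-bounded {k} {c} {d} k≤X (bounds c≤ d≤) = bounds
      (λ j → ℕ.≤-trans (ℕ.≤-reflexive (trans (cong ∣_∣ (Vec.lookup-map j ℤ.-_ c)) (ℤ.∣-i∣≡∣i∣ (lookup c j))))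
                       (ℕ.≤-trans (c≤ j) (entryBound≤2^E k≤X)))
      (begin
        ∣ ℤ.- (d ℤ.- 1ℤ) ∣                        ≡⟨ ℤ.∣-i∣≡∣i∣ (d ℤ.- 1ℤ) ⟩
        ∣ d ℤ.- 1ℤ ∣                              ≤⟨ ℤ.∣i-j∣≤∣i∣+∣j∣ d 1ℤ ⟩
        ∣ d ∣ ℕ.+ 1                               ≤⟨ ℕ.+-mono-≤ (ℕ.≤-trans d≤ d≤′) (ℕ.m^n>0 2 (X ℕ.* suc X)) ⟩
        2^e ℕ.+ 2^e                               ≡⟨ cong (2^e ℕ.+_) (ℕ.+-identityʳ 2^e) ⟨
        2 ℕ.^ E                                   ∎)
      where
      open ℕ.≤-Reasoning
      2^e = 2 ℕ.^ (X ℕ.* suc X)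
      d≤′ : entryBound k ℕ.≤ 2^e
      d≤′ = entryBound-mono k≤X

    -- path labels the rightmost branch, whose end is the only open leaf of the
    -- tree built so far; extend closes the tree from a subtree hung there.
    record Simulation (Γ : System n) : Set where
      field
        path      : System n
        short     : length path ℕ.≤ length Γ
        entries   : ListAll.All (Bounded (entryBound (length Γ))) path
        derived   : ListAll.All (Derivable (S ++ path)) Γ
        extend    : (τ : SPTree S path) →
                    Σ[ τ′ ∈ SPTree S [] ] sizeSP τ′ ℕ.≤ sizeSP τ ℕ.+ length Γ ℕ.* querySize X

    open Simulation

    path-length : ∀ {Γ} (σ : Simulation Γ) → length S ℕ.+ length Γ ℕ.≤ X → length (S ++ path σ) ℕ.≤ X
    path-length σ len = ℕ.≤-trans (ℕ.≤-reflexive (List.length-++ S))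
      (ℕ.≤-trans (ℕ.+-monoʳ-≤ (length S) (short σ)) len)

    all-entries : ∀ {Γ} (σ : Simulation Γ) → ListAll.All (Bounded (entryBound (length Γ))) (S ++ path σ)
    all-entries {Γ} σ = ListAll.++⁺ (ListAll.map (Bounded-mono (2^X≤entryBound (length Γ))) S-bounded) (entries σ)

    no-query : ∀ {Γ I} (σ : Simulation Γ) → Derivable (S ++ path σ) I → Simulation (I ∷ Γ)
    no-query {Γ} σ δ = record
      { path    = path σ
      ; short   = ℕ.m≤n⇒m≤1+n (short σ)
      ; entries = ListAll.map (Bounded-mono (entryBound-mono (ℕ.n≤1+n (length Γ)))) (entries σ)
      ; derived = δ ∷ derived σ
      ; extend  = λ τ → let τ′ , size≤ = extend σ τ in
                  τ′ , ℕ.≤-trans size≤ (ℕ.+-monoʳ-≤ (sizeSP τ) (ℕ.m≤n+m _ (querySize X)))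
      }

    query-cut : ∀ {Γ I} (σ : Simulation Γ) → length S ℕ.+ suc (length Γ) ℕ.≤ X →
                DivisionCut S (path σ) (entryBound (length Γ)) I → Simulation (I ∷ Γ)
    query-cut {Γ} {I} σ len (divisionCut c d bounded refuted implies) = record
      { path    = (c ·x≥ d) ∷ path σ
      ; short   = s≤s (short σ)
      ; entries = cut-bounded ∷ ListAll.map (Bounded-mono (entryBound-mono (ℕ.n≤1+n (length Γ)))) (entries σ)
      ; derived = implies ∷ ListAll.map (weaken S) (derived σ)
      ; extend  = extend′
      }
      where
      len′ : length S ℕ.+ length Γ ℕ.≤ X
      len′ = ℕ.≤-trans (ℕ.+-monoʳ-≤ (length S) (ℕ.n≤1+n (length Γ))) len
      suc≤X : suc (length Γ) ℕ.≤ X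
      suc≤X = ℕ.m+n≤o⇒n≤o (length S) len
      cut-bounded : Bounded (entryBound (suc (length Γ))) (c ·x≥ d)
      cut-bounded = Bounded-mono (entryBound-suc (length Γ) (path-length σ len′)) bounded
      left : List (Inequality n)
      left = (c ·x≤ (d ℤ.- 1ℤ)) ∷ path σ
      left-length : length (S ++ left) ℕ.≤ X
      left-length = ℕ.≤-trans (ℕ.≤-reflexive (List.length-++ S))
        (ℕ.≤-trans (ℕ.+-monoʳ-≤ (length S) (s≤s (short σ))) len)
      negated : Bounded (2 ℕ.^ E) (c ·x≤ (d ℤ.- 1ℤ))
      negated = negation-bounded suc≤X cut-bounded
      left-entries : ListAll.All (Bounded (2 ℕ.^ E)) (S ++ left)
      left-entries with S≤ , P≤ ← ListAll.++⁻ S (ListAll.map (Bounded-mono (entryBound≤2^E (ℕ.<⇒≤ suc≤X))) (all-entries σ))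
        = ListAll.++⁺ S≤ (negated ∷ P≤)
      left-leaf = small-leaf {S} {left} left-length left-entries refuted
      extend′ : (τ : SPTree S ((c ·x≥ d) ∷ path σ)) →
                Σ[ τ′ ∈ SPTree S [] ] sizeSP τ′ ℕ.≤ sizeSP τ ℕ.+ suc (length Γ) ℕ.* querySize X
      extend′ τ =
        let κ  , κ≤    = left-leaf
            -- The query is hung at the old open leaf: its left child is closed at once, and its
            -- right child is the new open leaf, filled by `τ`.
            τ′ , size≤ = extend σ (query c d (leaf κ) τ)
        in τ′ , ℕ.≤-trans size≤ (query-size X (sizeSP τ) (length Γ)
                  (labelSize-bound negated) (labelSize-bound (Bounded-mono (entryBound≤2^E suc≤X) cut-bounded)) κ≤)

    simulate : ∀ {Γ} → CPDerivation S Γ → length S ℕ.+ length Γ ℕ.≤ X → Simulation Γ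
    simulate [] _ = record
      { path = [] ; short = z≤n ; entries = [] ; derived = []
      ; extend = λ τ → τ , ℕ.≤-reflexive (sym (ℕ.+-identityʳ (sizeSP τ))) }
    simulate (_∷_ {Γ} step π) len = simulate-step step
      where
      σ : Simulation Γ
      σ = simulate π (ℕ.≤-trans (ℕ.+-monoʳ-≤ (length S) (ℕ.n≤1+n (length Γ))) len)
      simulate-step : ∀ {I} → CPStep S Γ I → Simulation (I ∷ Γ)
      simulate-step (hypothesis I∈S) = no-query σ (member-derivable (∈-++⁺ˡ I∈S))
      simulate-step (conic J∈Γ K∈Γ κ) = no-query σ
        (conic-derivable (ListAll.lookup (derived σ) J∈Γ ∷ ListAll.lookup (derived σ) K∈Γ ∷ []) κ)
      simulate-step (division t a∈Γ a≡) = query-cut σ len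
        (divide t (all-entries σ) a≡ (ListAll.lookup (derived σ) a∈Γ))

    -- A derivation of 0 ≥ 1 from `S ++ path σ` is a Farkas certificate, which after shrinking
    -- closes the remaining open leaf.
    refute : ∀ {Γ} → Simulation (0≥1 ∷ Γ) → length S ℕ.+ suc (length Γ) ℕ.≤ X →
             Σ[ τ ∈ SPRefutation S ] sizeSP τ ℕ.≤ leafSize X ℕ.+ X ℕ.* querySize X
    refute {Γ} σ len =
      let κ , κ≤ = final-leaf
          τ , τ≤ = extend σ (leaf κ)
      in τ , ℕ.≤-trans τ≤ (ℕ.+-mono-≤ κ≤ (ℕ.*-monoˡ-≤ (querySize X) Γ≤X))
      where
      Γ≤X : suc (length Γ) ℕ.≤ X
      Γ≤X = ℕ.m+n≤o⇒n≤o (length S) len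
      final-leaf = small-leaf {S} {path σ} (path-length σ len)
        (ListAll.map (Bounded-mono (entryBound≤2^E Γ≤X)) (all-entries σ))
        (proj₂ (0≥1-certificate (ListAll.head (derived σ))))

-- The polynomial bound

sizeBound : Polynomial
-- These are the coefficients of `leafSize X ℕ.+ X ℕ.* querySize X`, expanded in powers of `X`.
sizeBound = 2 ∷ 15 ∷ 20 ∷ 17 ∷ 9 ∷ 2 ∷ []

eval-sizeBound : ∀ X → eval sizeBound X ≡ leafSize X ℕ.+ X ℕ.* querySize X
eval-sizeBound = expand
  where
  expand : ∀ X →
    2 ℕ.+ X ℕ.* (15 ℕ.+ X ℕ.* (20 ℕ.+ X ℕ.* (17 ℕ.+ X ℕ.* (9 ℕ.+ X ℕ.* (2 ℕ.+ X ℕ.* 0))))) ≡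
    (let e     = suc (X ℕ.* suc X)
         v     = (2 ℕ.+ (X ℕ.+ e)) ℕ.* X
         leaf  = 2 ℕ.+ X ℕ.* (3 ℕ.+ v ℕ.+ (X ℕ.+ (v ℕ.+ e)))
         label = suc (X ℕ.* (2 ℕ.+ e)) ℕ.+ (2 ℕ.+ e)
     in leaf ℕ.+ X ℕ.* (1 ℕ.+ label ℕ.+ label ℕ.+ leaf))
  expand = ℕ-solve-∀

theorem4p1 : Σ[ p ∈ Polynomial ]
    (∀ (n : ℕ) (S : System n) → Unsatisfiable S →
    ∀ (π : CPRefutation S) →
    Σ[ τ ∈ SPRefutation S ] sizeSP τ ≤ eval p (sizeCP π + sizeSystem S))
-- X = s + L dominates the number of variables, the digits of the entries of `S`, and the number of
-- inequalities available at any leaf.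
theorem4p1 = sizeBound , λ n S unsat (Γ , π) →
  let L     = sizeSystem S
      s     = suc (length Γ)
      L≤X   = ℕ.m≤n+m L s
      S≤2^X = ListAll.map (λ size≤ → sizeInequality⇒Bounded (ℕ.≤-trans size≤ L≤X)) (sizeInequality≤sizeSystem S)
      n≤X   = ℕ.≤-trans (unsatisfiable⇒variables≤size S unsat) L≤X
      len   = ℕ.≤-trans (ℕ.+-monoˡ-≤ s (ℕ.<⇒≤ (length<sizeSystem S))) (ℕ.≤-reflexive (ℕ.+-comm L s))
      τ , τ≤ = refute n≤X S S≤2^X (simulate n≤X S S≤2^X π len) len
  in τ , ℕ.≤-trans τ≤ (ℕ.≤-reflexive (sym (eval-sizeBound (s + L))))
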